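{- Let $n$ be a positive integer and $U$ a subset of the vertex set $V$ of the complete graph $K_n$ with $2 \le |U| \le n-1$. Then the clique number of the $1$-skeleton of $SVMST_{n,U}$ satisfies $$\omega(SVMST_{n,U}) \geq 2^{\left(\sqrt{\left\lfloor \frac{n-|U|-1}{2}\right\rfloor} - 9\right)/2}.$$
   Context: Let $K_n=(V,E)$ be the complete graph on $n$ vertices, $d=n(n-1)/2$, and identify the coordinates of $\mathbb{R}^d$ with the edges of $K_n$. For a subgraph $t$ of $K_n$, its characteristic vector $x(t)\in\{0,1\}^d$ has coordinate $1$ exactly at the edges of $t$. A leaf of a tree is a vertex of degree $1$. For $U\subseteq V$, the polytope $SVMST_{n,U}$ is the convex hull of the characteristic vectors of all spanning trees of $K_n$ all of whose leaves belong to $U$. The $1$-skeleton of a polytope is the graph whose vertices are the polytope's vertices and whose edges are its $1$-dimensional faces; the clique number $\omega$ is the maximum size of a set of pairwise adjacent vertices. -}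

module Defs where

open import Data.Nat as ℕ using (ℕ; zero; suc; _≤_; _∸_; _^_)
open import Data.Nat.DivMod using (_/_)
open import Data.Integer as ℤ using (ℤ; +_)
open import Data.Bool using (Bool; true; false; if_then_else_)
open import Data.Fin using (Fin; _<_; _<?_)
open import Data.Fin.Subset using (Subset; _∈_; ∣_∣)
open import Data.Vec using (tabulate)
open import Data.List using (List; []; _∷_; length; allFin; foldr; map)
open import Data.List.Relation.Unary.All using (All)
open import Data.List.Relation.Unary.AllPairs using (AllPairs)
open import Data.List.Relation.Unary.Unique.Propositional using (Unique)
open import Data.Product using (Σ; _×_; _,_; proj₁; proj₂; ∃-syntax)
open import Relation.Nullary using (¬_; yes; no)
open import Relation.Binary.PropositionalEquality using (_≡_)

Edge : ℕ → Set
Edge n = Σ (Fin n × Fin n) (λ p → proj₁ p < proj₂ p)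

-- A spanning subgraph of K_n, given by its edge set; its characteristic
-- vector is the 0/1 vector  e ↦ (if t e then 1 else 0).
Subgraph : ℕ → Set
Subgraph n = Edge n → Bool

-- Points of ℤ^d ⊆ ℝ^d (we only need 0/1 points) and linear functionals.
Point : ℕ → Set
Point n = Edge n → Bool

charVec : ∀ {n} → Subgraph n → Point n
charVec t = t

adj : ∀ {n} → Subgraph n → Fin n → Fin n → Bool
adj t i j with i <? j
... | yes p = t ((i , j) , p)
... | no _ with j <? i
...   | yes q = t ((j , i) , q)
...   | no _ = false

degree : ∀ {n} → Subgraph n → Fin n → ℕ
degree t i = ∣ tabulate (adj t i) ∣

data Walk {n} (t : Subgraph n) : Fin n → Fin n → Set where
  here : ∀ {u} → Walk t u u
  step : ∀ {u v w} → adj t u v ≡ true → Walk t v w → Walk t u w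

Connected : ∀ {n} → Subgraph n → Set
Connected {n} t = (u v : Fin n) → Walk t u v

Chain : ∀ {n} → Subgraph n → Fin n → List (Fin n) → Set
Chain t u [] = Data.Unit.⊤ where import Data.Unit
Chain t u (v ∷ vs) = (adj t u v ≡ true) × Chain t v vs

lastOf : ∀ {A : Set} → A → List A → A
lastOf a [] = a
lastOf a (b ∷ bs) = lastOf b bs

IsCycle : ∀ {n} → Subgraph n → List (Fin n) → Set
IsCycle t [] = Data.Empty.⊥ where import Data.Empty
IsCycle t (v ∷ vs) =
  (3 ≤ length (v ∷ vs)) × Unique (v ∷ vs) × Chain t v vs × (adj t (lastOf v vs) v ≡ true)

Acyclic : ∀ {n} → Subgraph n → Set
Acyclic {n} t = (c : List (Fin n)) → ¬ IsCycle t c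

IsSpanningTree : ∀ {n} → Subgraph n → Set
IsSpanningTree t = Connected t × Acyclic t

IsLeaf : ∀ {n} → Subgraph n → Fin n → Set
IsLeaf t v = degree t v ≡ 1

LeavesIn : ∀ {n} → Subgraph n → Subset n → Set
LeavesIn {n} t U = (v : Fin n) → IsLeaf t v → v ∈ U

-- generating point set of SVMST_{n,U}
InS : (n : ℕ) → Subset n → Point n → Set
InS n U x = ∃[ t ] (IsSpanningTree t × LeavesIn t U × ((e : Edge n) → x e ≡ charVec t e))

Functional : ℕ → Set
Functional n = Edge n → ℤ

b2z : Bool → ℤ
b2z true = + 1
b2z false = + 0

sumFin : ∀ {n} → (Fin n → ℤ) → ℤ
sumFin {n} f = foldr ℤ._+_ (+ 0) (map f (allFin n))

dot : ∀ {n} → Functional n → Point n → ℤ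
dot {n} c x = sumFin (λ i → sumFin (λ j → term i j))
  where
  term : Fin n → Fin n → ℤ
  term i j with i <? j
  ... | yes p = c ((i , j) , p) ℤ.* b2z (x ((i , j) , p))
  ... | no _ = + 0

SamePt : ∀ {n} → Point n → Point n → Set
SamePt {n} x y = (e : Edge n) → x e ≡ y e

-- x is a vertex of conv(S): an exposed point (a 0-dimensional face)
IsVertex : (n : ℕ) → Subset n → Point n → Set
IsVertex n U x = InS n U x × ∃[ c ] ((z : Point n) → InS n U z → ¬ SamePt z x → dot c z ℤ.< dot c x)

-- x, y span an edge (1-dimensional face) of conv(S): some linear functional
-- is maximised over S exactly at {x, y}
Adjacent : (n : ℕ) → Subset n → Point n → Point n → Set
Adjacent n U x y =
  IsVertex n U x × IsVertex n U y × ¬ SamePt x y ×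
  ∃[ c ] ((dot c x ≡ dot c y) ×
          ((z : Point n) → InS n U z → ¬ SamePt z x → ¬ SamePt z y → dot c z ℤ.< dot c x))

IsClique : (n : ℕ) → Subset n → List (Point n) → Set
IsClique n U xs = All (IsVertex n U) xs × AllPairs (Adjacent n U) xs

-- k ≥ 2^((√m - 9)/2), i.e. 2^(√m - 9) ≤ k², encoded exactly over ℕ:
-- for all rationals a/q with 0 ≤ a/q ≤ √m (a² ≤ q² m, q ≥ 1) we have
-- 2^(a/q - 9) ≤ k², i.e. 2^a ≤ 2^(9q) · k^(2q).  (By density of ℚ and
-- continuity of 2^x this is equivalent to the real inequality; the case
-- a = 0 forces k ≥ 1.)
BoundHolds : ℕ → ℕ → Set
BoundHolds m k = (a q : ℕ) → 1 ≤ q → a ℕ.* a ≤ (q ℕ.* q) ℕ.* m →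
  2 ^ a ≤ (2 ^ (9 ℕ.* q)) ℕ.* (k ^ (2 ℕ.* q))

mOf : (n : ℕ) → Subset n → ℕ
mOf n U = (n ∸ ∣ U ∣ ∸ 1) / 2

{-# OPTIONS --safe #-}
module Submission where

-- For bit words b of length p there is a Hamiltonian path H b between two vertices of U,
-- through all the others, made of p rows of p bundles.  Row i is traversed in one of two
-- ways according to b i, and bundle (i , j) is cross-wired with bundle (j , i) according
-- to b i xor b j, in such a way that a wiring which does not match the states of both
-- rows closes an 8-cycle.  A suitable functional shows that H b and H b' are adjacent as
-- soon as no other tree has at each vertex the neighbours it has in H b or in H b'.
-- In such a tree, each row with b i ≢ b' i follows only one of the two paths, because
-- the edges in which H b and H b' differ connect that row.  Two such rows have the same
-- wiring in both paths, so acyclicity makes them follow the same one; by acyclicity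
-- again, so do the wirings between them and the other rows.  The paths use
-- 8 p² + 2 p + 1 vertices outside U, hence a clique of size 2 ^ p with p of order √m / 2.

open import Defs
open import Data.Bool as Bool using (Bool; true; false; if_then_else_; not; _∧_; _xor_)
open import Data.Bool.Properties using (not-involutive; not-distribʳ-xor; xor-inverseˡ; xor-same; xor-comm) renaming (_≟_ to _≟ᵇ_)
open import Data.Empty using (⊥; ⊥-elim)
open import Data.Fin as Fin using (Fin; zero; suc; toℕ; fromℕ; inject₁; _<_; _<?_)
open import Data.Fin.Properties using (+↔⊎; *↔×; 2↔Bool; toℕ-fromℕ; toℕ-inject₁; toℕ-cast; cast-involutive; splitAt-≥) renaming (_≟_ to _≟ᶠ_; <-cmp to <ᶠ-cmp)
open import Data.Fin.Subset using (Subset; _∈_; ∣_∣)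
open import Data.Integer as ℤ using (ℤ; +_)
import Data.Integer.Properties as ℤ
open import Data.List as List using (List; []; _∷_; length; foldr; map; _++_)
open import Data.List.Membership.Propositional using () renaming (_∈_ to _∈ˡ_)
open import Data.List.Properties using (length-++; length-map; map-tabulate)
open import Data.List.Relation.Unary.All as All using (All; []; _∷_)
import Data.List.Relation.Unary.All.Properties as All
open import Data.List.Relation.Unary.AllPairs as AllPairs using (AllPairs; []; _∷_)
import Data.List.Relation.Unary.AllPairs.Properties as AllPairs
open import Data.List.Relation.Unary.Any using (here; there)
open import Data.List.Relation.Unary.Unique.Propositional using (Unique)
open import Data.List.Relation.Unary.Unique.Propositional.Properties using (map⁺)
open import Data.Maybe as Maybe using (Maybe; just; nothing; maybe)
open import Data.Maybe.Properties using (just-injective) renaming (≡-dec to ≡-decᵐ)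
open import Data.Nat as ℕ using (ℕ; zero; suc; _+_; _*_; _∸_; _^_; _≤_; _<ᵇ_; z≤n; s≤s)
open import Data.Nat.DivMod using (_/_; m/n*n≤m)
open import Data.Nat.Induction using (<-wellFounded)
import Data.Nat.Properties as ℕ
open import Data.Nat.Solver using (module +-*-Solver)
open import Data.Product using (Σ; _×_; _,_; proj₁; proj₂; ∃-syntax)
open import Data.Product.Function.NonDependent.Propositional using (_×-↔_)
open import Data.Sum as Sum using (_⊎_; inj₁; inj₂; swap)
open import Data.Sum.Function.Propositional using (_⊎-↔_)
open import Data.Vec using ([]; _∷_; here; there; tabulate)
import Data.Vec.Functional as Vector
open import Function using (_∘_; id; _↔_; Inverse; mk⇔; mk↔ₛ′)
open import Function.Construct.Composition using (_↔-∘_)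
open import Function.Construct.Identity using (↔-id)
open import Induction.WellFounded using (Acc; acc)
open import Relation.Binary using (tri<; tri≈; tri>; DecidableEquality)
open import Relation.Binary.PropositionalEquality using (_≡_; _≢_; refl; sym; trans; cong; cong₂; subst; subst₂; module ≡-Reasoning)
open import Relation.Nullary using (¬_; Dec; yes; no; does; _⊎-dec_)
open import Relation.Nullary.Decidable using (map′; dec-true; dec-false; does-⇔)
open import Algebra.Properties.AbelianGroup ℤ.+-0-abelianGroup using (∙-cancelʳ)
open import Algebra.Properties.CommutativeMonoid.Sum ℤ.+-0-commutativeMonoid using (sum; ∑-comm; ∑-distrib-+; sum-cong-≗; sum-replicate-zero)

-- Adjacency from a separating functional

-- Rows switched independently would not suffice: if b and b' differ in two rows, following b in one
-- and b' in the other would be the path of a third word, and this tree has at every vertex the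
-- neighbours it has in one of the two. The wiring is there to destroy such mixtures. It depends
-- only on b i xor b j, which is unchanged when both rows flip, so a mixture cannot acquire the
-- wiring that its own states would require. The price is one bundle of 8 vertices for each ordered
-- pair of rows. This is where the square root comes from: half of 8 p² is (2 p)², so √m is about 2
-- p. The lower order terms and the rounding of p are absorbed by choosing p with √m at most 2 p + 9
-- and, unless p is 0, at least 2 p + 7. Every vertex keeps one neighbour, its `mate`, in all the
-- paths, so two paths differ at a vertex in at most one neighbour. This is what allows a degree
-- bound of 2 to pin down neighbourhoods one vertex at a time.

sum-mono-≤ : ∀ {n} {f g : Fin n → ℤ} → (∀ i → f i ℤ.≤ g i) → sum f ℤ.≤ sum g
sum-mono-≤ {zero} f≤g = ℤ.≤-refl
sum-mono-≤ {suc n} f≤g = ℤ.+-mono-≤ (f≤g zero) (sum-mono-≤ (f≤g ∘ suc))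

sum-mono-≤-tight : ∀ {n} {f g : Fin n → ℤ} → (∀ i → f i ℤ.≤ g i) → sum g ℤ.≤ sum f → ∀ i → f i ≡ g i
sum-mono-≤-tight {suc n} {f} {g} f≤g Σg≤Σf zero with ℤ.<-cmp (f zero) (g zero)
... | tri≈ _ e _ = e
... | tri> _ _ h = ⊥-elim (ℤ.<⇒≱ h (f≤g zero))
... | tri< h _ _ = ⊥-elim (ℤ.<⇒≱ (ℤ.+-mono-<-≤ h (sum-mono-≤ (f≤g ∘ suc))) Σg≤Σf)
sum-mono-≤-tight {suc n} {f} {g} f≤g Σg≤Σf (suc i) = sum-mono-≤-tight (f≤g ∘ suc) rest i
  where
  rest : sum (g ∘ suc) ℤ.≤ sum (f ∘ suc)
  rest with sum (g ∘ suc) ℤ.≤? sum (f ∘ suc)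
  ... | yes h = h
  ... | no h = ⊥-elim (ℤ.<⇒≱ (ℤ.+-mono-≤-< (f≤g zero) (ℤ.≰⇒> h)) Σg≤Σf)

sumFin≡sum : ∀ {n} (f : Fin n → ℤ) → sumFin f ≡ sum f
sumFin≡sum f = trans (cong (foldr ℤ._+_ (+ 0)) (map-tabulate (λ i → i) f)) (go f)
  where
  go : ∀ {n} (f : Fin n → ℤ) → foldr ℤ._+_ (+ 0) (List.tabulate f) ≡ sum f
  go {zero} f = refl
  go {suc n} f = cong (λ s → f zero ℤ.+ s) (go (f ∘ suc))

∣tabulate∣≡sum : ∀ {n} (f : Fin n → Bool) → + ∣ tabulate f ∣ ≡ sum (λ i → b2z (f i))
∣tabulate∣≡sum {zero} f = refl
∣tabulate∣≡sum {suc n} f with f zero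
... | true = trans (ℤ.pos-+ 1 _) (cong (λ s → + 1 ℤ.+ s) (∣tabulate∣≡sum (f ∘ suc)))
... | false = trans (∣tabulate∣≡sum (f ∘ suc)) (sym (ℤ.+-identityˡ _))

does-≟ : ∀ {n} → Fin n → Fin n → Bool
does-≟ a j = Dec.does (a ≟ᶠ j)

sum-indicator : ∀ {n} (a : Fin n) → sum (λ j → b2z (does-≟ a j)) ≡ + 1
sum-indicator {suc n} zero = cong (λ s → + 1 ℤ.+ s) (sum-replicate-zero n)
sum-indicator {suc n} (suc a) = trans (ℤ.+-identityˡ _) (trans (sum-cong-≗ eq) (sum-indicator a))
  where
  eq : ∀ j → b2z (does-≟ (suc a) (suc j)) ≡ b2z (does-≟ a j)
  eq j with a ≟ᶠ j
  ... | yes _ = refl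
  ... | no _ = refl

module _ {n : ℕ} where

  adj-< : (t : Subgraph n) {i j : Fin n} (i<j : i < j) → adj t i j ≡ t ((i , j) , i<j)
  adj-< t {i} {j} i<j with i <? j
  ... | yes q = cong (λ r → t ((i , j) , r)) (ℕ.<-irrelevant q i<j)
  ... | no i≮j = ⊥-elim (i≮j i<j)

  adj-> : (t : Subgraph n) {i j : Fin n} (j<i : j < i) → adj t i j ≡ t ((j , i) , j<i)
  adj-> t {i} {j} j<i with i <? j
  ... | yes i<j = ⊥-elim (ℕ.<-asym i<j j<i)
  ... | no _ with j <? i
  ...   | yes q = cong (λ r → t ((j , i) , r)) (ℕ.<-irrelevant q j<i)
  ...   | no j≮i = ⊥-elim (j≮i j<i)

  adj-irrefl : (t : Subgraph n) (i : Fin n) → adj t i i ≡ false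
  adj-irrefl t i with i <? i
  ... | yes i<i = ⊥-elim (ℕ.<-irrefl refl i<i)
  ... | no _ with i <? i
  ...   | yes i<i = ⊥-elim (ℕ.<-irrefl refl i<i)
  ...   | no _ = refl

  adj-sym : (t : Subgraph n) (i j : Fin n) → adj t i j ≡ adj t j i
  adj-sym t i j with <ᶠ-cmp i j
  ... | tri< i<j _ _ = trans (adj-< t i<j) (sym (adj-> t i<j))
  ... | tri≈ _ refl _ = refl
  ... | tri> _ _ j<i = trans (adj-> t j<i) (sym (adj-< t j<i))

  adj-cong : {s t : Subgraph n} → (∀ e → s e ≡ t e) → ∀ i j → adj s i j ≡ adj t i j
  adj-cong {s} {t} s≗t i j with <ᶠ-cmp i j
  ... | tri< i<j _ _ = trans (adj-< s i<j) (trans (s≗t _) (sym (adj-< t i<j)))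
  ... | tri≈ _ refl _ = trans (adj-irrefl s i) (sym (adj-irrefl t i))
  ... | tri> _ _ j<i = trans (adj-> s j<i) (trans (s≗t _) (sym (adj-> t j<i)))

  adj-injective : {s t : Subgraph n} → (∀ i j → adj s i j ≡ adj t i j) → SamePt s t
  adj-injective {s} {t} eq ((i , j) , i<j) = trans (sym (adj-< s i<j)) (trans (eq i j) (adj-< t i<j))

  SameAt : Point n → Point n → Fin n → Set
  SameAt z x i = ∀ j → adj z i j ≡ adj x i j

  -- Names the summand that `dot` keeps in a local definition.
  dot-summand : (c : Functional n) (x : Point n) →
    Σ (Fin n → Fin n → ℤ) (λ t → dot c x ≡ sumFin (λ i → sumFin (λ j → t i j)))
  dot-summand c x = _ , refl

  dot-summand-< : ∀ c x {i j} (i<j : i < j) →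
    proj₁ (dot-summand c x) i j ≡ c ((i , j) , i<j) ℤ.* b2z (x ((i , j) , i<j))
  dot-summand-< c x {i} {j} i<j with i <? j
  ... | yes q rewrite ℕ.<-irrelevant q i<j = refl
  ... | no i≮j = ⊥-elim (i≮j i<j)

  dot-summand-≮ : ∀ c x {i j} → ¬ (i < j) → proj₁ (dot-summand c x) i j ≡ + 0
  dot-summand-≮ c x {i} {j} i≮j with i <? j
  ... | yes q = ⊥-elim (i≮j q)
  ... | no _ = refl

  symmetrized : (Fin n → Fin n → ℤ) → Functional n
  symmetrized h ((i , j) , _) = h i j ℤ.+ h j i

  local : (Fin n → Fin n → ℤ) → Point n → Fin n → ℤ
  local h z i = sum (λ j → h i j ℤ.* b2z (adj z i j))

  upper : (Fin n → Fin n → ℤ) → Point n → Fin n → Fin n → ℤ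
  upper h z i j with i <? j
  ... | yes i<j = h i j ℤ.* b2z (z ((i , j) , i<j))
  ... | no _ = + 0

  upper-< : ∀ h z {i j} (i<j : i < j) → upper h z i j ≡ h i j ℤ.* b2z (adj z i j)
  upper-< h z {i} {j} i<j rewrite adj-< z i<j with i <? j
  ... | yes q rewrite ℕ.<-irrelevant q i<j = refl
  ... | no i≮j = ⊥-elim (i≮j i<j)

  upper-≮ : ∀ h z {i j} → ¬ (i < j) → upper h z i j ≡ + 0
  upper-≮ h z {i} {j} i≮j with i <? j
  ... | yes i<j = ⊥-elim (i≮j i<j)
  ... | no _ = refl

  -- The handshake identity, with weights.
  dot-symmetrized : ∀ h z → dot (symmetrized h) z ≡ sum (local h z)
  dot-symmetrized h z = begin
    dot (symmetrized h) z
      ≡⟨ sumFin≡sum (λ i → sumFin (d i)) ⟩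
    sum (λ i → sumFin (d i))
      ≡⟨ sum-cong-≗ (λ i → sumFin≡sum (d i)) ⟩
    sum (λ i → sum (d i))
      ≡⟨ sum-cong-≗ (λ i → sum-cong-≗ (split i)) ⟩
    sum (λ i → sum (λ j → upper h z i j ℤ.+ upper hᵀ z i j))
      ≡⟨ sum-cong-≗ (λ i → ∑-distrib-+ (upper h z i) (upper hᵀ z i)) ⟩
    sum (λ i → sum (upper h z i) ℤ.+ sum (upper hᵀ z i))
      ≡⟨ ∑-distrib-+ (λ i → sum (upper h z i)) (λ i → sum (upper hᵀ z i)) ⟩
    sum (λ i → sum (upper h z i)) ℤ.+ sum (λ i → sum (upper hᵀ z i))
      -- Each edge i < j carries h i j and h j i. Transposing the second half of the sum assigns h j
      -- i to the end j.
      ≡⟨ cong (λ s → sum (λ i → sum (upper h z i)) ℤ.+ s) (∑-comm (upper hᵀ z)) ⟩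
    sum (λ i → sum (upper h z i)) ℤ.+ sum (λ i → sum (λ j → upper hᵀ z j i))
      ≡⟨ ∑-distrib-+ (λ i → sum (upper h z i)) (λ i → sum (λ j → upper hᵀ z j i)) ⟨
    sum (λ i → sum (upper h z i) ℤ.+ sum (λ j → upper hᵀ z j i))
      ≡⟨ sum-cong-≗ (λ i → ∑-distrib-+ (upper h z i) (λ j → upper hᵀ z j i)) ⟨
    sum (λ i → sum (λ j → upper h z i j ℤ.+ upper hᵀ z j i))
      ≡⟨ sum-cong-≗ (λ i → sum-cong-≗ (merge i)) ⟩
    sum (local h z) ∎
    where
    open ≡-Reasoning
    d = proj₁ (dot-summand (symmetrized h) z)
    hᵀ : Fin n → Fin n → ℤ
    hᵀ i j = h j i

    split : ∀ i j → d i j ≡ upper h z i j ℤ.+ upper hᵀ z i j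
    split i j = go (i <? j)
      where
      go : Dec (i < j) → d i j ≡ upper h z i j ℤ.+ upper hᵀ z i j
      go (yes i<j) rewrite dot-summand-< (symmetrized h) z i<j | upper-< h z i<j | upper-< hᵀ z i<j | adj-< z i<j =
        ℤ.*-distribʳ-+ (b2z (z ((i , j) , i<j))) (h i j) (h j i)
      go (no i≮j) rewrite dot-summand-≮ (symmetrized h) z i≮j | upper-≮ h z i≮j | upper-≮ hᵀ z i≮j = refl

    merge : ∀ i j → upper h z i j ℤ.+ upper hᵀ z j i ≡ h i j ℤ.* b2z (adj z i j)
    merge i j with <ᶠ-cmp i j
    ... | tri< i<j _ j≮i rewrite upper-< h z i<j | upper-≮ hᵀ z j≮i = ℤ.+-identityʳ _
    ... | tri> i≮j _ j<i rewrite upper-≮ h z i≮j | upper-< hᵀ z j<i | adj-sym z j i = ℤ.+-identityˡ _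
    ... | tri≈ i≮j refl _ rewrite upper-≮ h z i≮j | upper-≮ hᵀ z i≮j | adj-irrefl z i = sym (ℤ.*-zeroʳ (h i i))

  degree≡sum : (t : Subgraph n) (i : Fin n) → + degree t i ≡ sum (λ j → b2z (adj t i j))
  degree≡sum t i = ∣tabulate∣≡sum (adj t i)

  record HasNeighbours₂ (t : Subgraph n) (i a p : Fin n) : Set where
    field
      a≢p : a ≢ p
      adj-a : adj t i a ≡ true
      adj-p : adj t i p ≡ true
      adj-rest : ∀ j → j ≢ a → j ≢ p → adj t i j ≡ false

  sum-neighbours₂ : ∀ {t i a p} → HasNeighbours₂ t i a p → sum (λ j → b2z (adj t i j)) ≡ + 2
  sum-neighbours₂ {t} {i} {a} {p} N = begin
    sum (λ j → b2z (adj t i j))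
      ≡⟨ sum-cong-≗ eq ⟩
    sum (λ j → b2z (does-≟ a j) ℤ.+ b2z (does-≟ p j))
      ≡⟨ ∑-distrib-+ (λ j → b2z (does-≟ a j)) (λ j → b2z (does-≟ p j)) ⟩
    sum (λ j → b2z (does-≟ a j)) ℤ.+ sum (λ j → b2z (does-≟ p j))
      ≡⟨ cong₂ ℤ._+_ (sum-indicator a) (sum-indicator p) ⟩
    + 2 ∎
    where
    open ≡-Reasoning
    open HasNeighbours₂ N
    eq : ∀ j → b2z (adj t i j) ≡ b2z (does-≟ a j) ℤ.+ b2z (does-≟ p j)
    eq j with a ≟ᶠ j | p ≟ᶠ j
    ... | yes refl | yes refl = ⊥-elim (a≢p refl)
    ... | yes refl | no _ rewrite adj-a = refl
    ... | no _ | yes refl rewrite adj-p = refl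
    ... | no a≢j | no p≢j rewrite adj-rest j (a≢j ∘ sym) (p≢j ∘ sym) = refl

  degree-neighbours₂ : ∀ {t i a p} → HasNeighbours₂ t i a p → degree t i ≡ 2
  degree-neighbours₂ {t} {i} N = ℤ.+-injective (trans (degree≡sum t i) (sum-neighbours₂ N))

  1≤degree : (t : Subgraph n) (i j : Fin n) → adj t i j ≡ true → 1 ℕ.≤ degree t i
  1≤degree t i j ij = ℤ.drop‿+≤+ (subst (+ 1 ℤ.≤_) (sym (degree≡sum t i))
    (subst (ℤ._≤ sum (λ k → b2z (adj t i k))) (sum-indicator j) (sum-mono-≤ le)))
    where
    le : ∀ k → b2z (does-≟ j k) ℤ.≤ b2z (adj t i k)
    le k with j ≟ᶠ k
    ... | yes refl rewrite ij = ℤ.≤-refl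
    ... | no _ with adj t i k
    ...   | true = ℤ.+≤+ z≤n
    ...   | false = ℤ.+≤+ z≤n

module _ {n : ℕ} {U : Subset n} where

  -- Connectedness gives i a neighbour, since another vertex k exists, and a vertex outside U is not
  -- a leaf.
  2≤degree : ∀ {z} → InS n U z → ∀ {i k} → k ≢ i → ¬ (i ∈ U) → + 2 ℤ.≤ sum (λ j → b2z (adj z i j))
  2≤degree {z} (t , (connected , _) , leaves , z≗t) {i} {k} k≢i i∉U =
    subst (+ 2 ℤ.≤_) (trans (degree≡sum t i) (sum-cong-≗ (λ j → cong b2z (sym (adj-cong z≗t i j)))))
      (ℤ.+≤+ (two (degree t i) (nonzero (connected i k)) (λ e → i∉U (leaves i e))))
    where
    nonzero : Walk t i k → 1 ℕ.≤ degree t i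
    nonzero here = ⊥-elim (k≢i refl)
    nonzero (step {v = v} iv _) = 1≤degree t i v iv
    two : ∀ d → 1 ℕ.≤ d → d ≢ 1 → 2 ℕ.≤ d
    two (suc zero) _ d≢1 = ⊥-elim (d≢1 refl)
    two (suc (suc d)) _ _ = s≤s (s≤s z≤n)

  record Moved (x y : Point n) (i : Fin n) : Set where
    field
      i∉U : ¬ (i ∈ U)
      a p q : Fin n
      at-x : HasNeighbours₂ x i a p
      at-y : HasNeighbours₂ y i a q
      p≢q : p ≢ q

  weight : Bool → Bool → ℤ
  weight true true = + 1
  weight true false = ℤ.- + 1
  weight false true = ℤ.- + 1
  weight false false = ℤ.- + 2

  weights : Point n → Point n → Fin n → Fin n → ℤ
  weights x y i j = weight (adj x i j) (adj y i j)

  Tight : (x y z : Point n) → Fin n → Set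
  Tight x y z i = local (weights x y) z i ℤ.≤ local (weights x y) x i ×
    (local (weights x y) x i ℤ.≤ local (weights x y) z i → SameAt z x i ⊎ SameAt z y i)

  -- Where x and y have the same neighbours only the weights 1 and -2 occur, so each summand is
  -- maximal on its own. No degree bound enters, and the vertex may lie in U.
  fixed-tight : ∀ {x y z i} → SameAt x y i → Tight x y z i
  fixed-tight {x} {y} {z} {i} x≈y = sum-mono-≤ le , λ h → inj₁ (λ j → eq j (sum-mono-≤-tight le h j))
    where
    h = weights x y
    le : ∀ j → h i j ℤ.* b2z (adj z i j) ℤ.≤ h i j ℤ.* b2z (adj x i j)
    le j rewrite sym (x≈y j) with adj x i j | adj z i j
    ... | true | true = ℤ.≤-refl
    ... | true | false = ℤ.+≤+ z≤n
    ... | false | true = ℤ.-≤+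
    ... | false | false = ℤ.≤-refl
    eq : ∀ j → h i j ℤ.* b2z (adj z i j) ≡ h i j ℤ.* b2z (adj x i j) → adj z i j ≡ adj x i j
    eq j rewrite sym (x≈y j) with adj x i j | adj z i j
    ... | true | true = λ _ → refl
    ... | true | false = λ ()
    ... | false | true = λ ()
    ... | false | false = λ _ → refl

  fixed-balanced : ∀ {x y i} → SameAt x y i → local (weights x y) x i ≡ local (weights x y) y i
  fixed-balanced {x} {y} {i} x≈y = sum-cong-≗ (λ j → cong (λ b → weights x y i j ℤ.* b2z b) (x≈y j))

  module _ {x y : Point n} {i : Fin n} (m : Moved x y i) where
    open Moved m
    open HasNeighbours₂ at-x renaming (adj-a to x-a; adj-p to x-p; adj-rest to x-rest; a≢p to a≢p)
    open HasNeighbours₂ at-y renaming (adj-a to y-a; adj-p to y-q; adj-rest to y-rest; a≢p to a≢q)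

    private
      h = weights x y
      -- Adding the degree shifts the weights 1, -1, -2 to 2, 0, -1: now p and q are neutral, and
      -- only the common neighbour a is worth having.
      reward : Point n → Fin n → ℤ
      reward z j = h i j ℤ.* b2z (adj z i j) ℤ.+ b2z (adj z i j)

      data Pos (j : Fin n) : Bool → Bool → Set where
        at-a : j ≡ a → Pos j true true
        at-p : j ≡ p → Pos j true false
        at-q : j ≡ q → Pos j false true
        off : j ≢ a → j ≢ p → j ≢ q → Pos j false false

      pos : ∀ j → Pos j (adj x i j) (adj y i j)
      pos j with j ≟ᶠ a | j ≟ᶠ p | j ≟ᶠ q
      ... | yes refl | _ | _ rewrite x-a | y-a = at-a refl
      ... | no _ | yes refl | _ rewrite x-p | y-rest j (a≢p ∘ sym) p≢q = at-p refl
      ... | no _ | no j≢p | yes refl rewrite y-q | x-rest j (a≢q ∘ sym) (p≢q ∘ sym) = at-q refl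
      ... | no j≢a | no j≢p | no j≢q rewrite x-rest j j≢a j≢p | y-rest j j≢a j≢q = off j≢a j≢p j≢q

      reward-≤ : ∀ z j → reward z j ℤ.≤ reward x j
      reward-≤ z j with adj x i j | adj y i j | adj z i j | pos j
      ... | _ | _ | true | at-a _ = ℤ.≤-refl
      ... | _ | _ | false | at-a _ = ℤ.+≤+ z≤n
      ... | _ | _ | true | at-p _ = ℤ.≤-refl
      ... | _ | _ | false | at-p _ = ℤ.≤-refl
      ... | _ | _ | true | at-q _ = ℤ.≤-refl
      ... | _ | _ | false | at-q _ = ℤ.≤-refl
      ... | _ | _ | true | off _ _ _ = ℤ.-≤+
      ... | _ | _ | false | off _ _ _ = ℤ.≤-refl

      reward-y : ∀ j → reward y j ≡ reward x j
      reward-y j with adj x i j | adj y i j | pos j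
      ... | _ | _ | at-a _ = refl
      ... | _ | _ | at-p _ = refl
      ... | _ | _ | at-q _ = refl
      ... | _ | _ | off _ _ _ = refl

      deg : Point n → ℤ
      deg z = sum (λ j → b2z (adj z i j))

      split : ∀ z → sum (reward z) ≡ local h z i ℤ.+ deg z
      split z = ∑-distrib-+ (λ j → h i j ℤ.* b2z (adj z i j)) (λ j → b2z (adj z i j))

      b2z-≤ : ∀ b → b2z b ℤ.≤ + 1
      b2z-≤ true = ℤ.≤-refl
      b2z-≤ false = ℤ.+≤+ z≤n
      0≤b2z : ∀ b → + 0 ℤ.≤ b2z b
      0≤b2z true = ℤ.+≤+ z≤n
      0≤b2z false = ℤ.≤-refl
      b2z-injective : ∀ b c → b2z b ≡ b2z c → b ≡ c
      b2z-injective true true _ = refl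
      b2z-injective false false _ = refl

      identify : ∀ z → (∀ j → reward z j ≡ reward x j) → deg z ≡ + 2 → SameAt z x i ⊎ SameAt z y i
      identify z r d with adj z i p in zp | adj z i q in zq
      ... | false | _ = inj₂ (λ j → b2z-injective _ _ (sum-mono-≤-tight le (ℤ.≤-reflexive (trans (sum-neighbours₂ at-y) (sym d))) j))
        where
        le : ∀ j → b2z (adj z i j) ℤ.≤ b2z (adj y i j)
        le j with adj x i j | adj y i j | pos j | r j
        ... | _ | _ | at-a _ | _ = b2z-≤ _
        ... | _ | _ | at-q _ | _ = b2z-≤ _
        ... | _ | _ | at-p refl | _ rewrite zp = ℤ.≤-refl
        ... | _ | _ | off _ _ _ | e with adj z i j
        ...   | false = ℤ.≤-refl
        ...   | true with () ← e
      ... | true | false = inj₁ (λ j → b2z-injective _ _ (sum-mono-≤-tight le (ℤ.≤-reflexive (trans (sum-neighbours₂ at-x) (sym d))) j))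
        where
        le : ∀ j → b2z (adj z i j) ℤ.≤ b2z (adj x i j)
        le j with adj x i j | adj y i j | pos j | r j
        ... | _ | _ | at-a _ | _ = b2z-≤ _
        ... | _ | _ | at-p _ | _ = b2z-≤ _
        ... | _ | _ | at-q refl | _ rewrite zq = ℤ.≤-refl
        ... | _ | _ | off _ _ _ | e with adj z i j
        ...   | false = ℤ.≤-refl
        ...   | true with () ← e
      ... | true | true = inj₁ (λ j → sym (b2z-injective _ _ (sum-mono-≤-tight le (ℤ.≤-reflexive (trans d (sym (sum-neighbours₂ at-x)))) j)))
        where
        le : ∀ j → b2z (adj x i j) ℤ.≤ b2z (adj z i j)
        le j with adj x i j | adj y i j | pos j | r j
        ... | _ | _ | at-p refl | _ rewrite zp = ℤ.≤-refl
        ... | _ | _ | at-q _ | _ = 0≤b2z _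
        ... | _ | _ | off _ _ _ | _ = 0≤b2z _
        ... | _ | _ | at-a _ | e with adj z i j
        ...   | true = ℤ.≤-refl
        ...   | false with () ← e

    moved-balanced : local h x i ≡ local h y i
    moved-balanced = ∙-cancelʳ (deg x) _ _ (begin
      local h x i ℤ.+ deg x ≡⟨ split x ⟨
      sum (reward x) ≡⟨ sum-cong-≗ reward-y ⟨
      sum (reward y) ≡⟨ split y ⟩
      local h y i ℤ.+ deg y ≡⟨ cong (λ s → local h y i ℤ.+ s) (trans (sum-neighbours₂ at-y) (sym (sum-neighbours₂ at-x))) ⟩
      local h y i ℤ.+ deg x ∎)
      where
      open ≡-Reasoning

    -- The local sum is the reward minus the degree. The reward is at most that of x and the degree
    -- at least 2, so equality forces both: a is a neighbour, nothing outside a, p, q is, and just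
    -- one of p, q completes degree 2.
    moved-tight : ∀ {z} → InS n U z → Tight x y z i
    moved-tight {z} z∈S = bound , λ h≥ → identify z (sum-mono-≤-tight (reward-≤ z) (reward≥ h≥)) (deg≡ h≥)
      where
      a≢i : a ≢ i
      a≢i refl with () ← trans (sym x-a) (adj-irrefl x i)
      2≤deg : deg x ℤ.≤ deg z
      2≤deg = subst (ℤ._≤ deg z) (sym (sum-neighbours₂ at-x)) (2≤degree z∈S a≢i i∉U)
      total : local h z i ℤ.+ deg z ℤ.≤ local h x i ℤ.+ deg x
      total = subst₂ ℤ._≤_ (split z) (split x) (sum-mono-≤ (reward-≤ z))
      bound : local h z i ℤ.≤ local h x i
      bound with local h z i ℤ.≤? local h x i
      ... | yes le = le
      ... | no ¬le = ⊥-elim (ℤ.<⇒≱ (ℤ.+-mono-<-≤ (ℤ.≰⇒> ¬le) 2≤deg) total)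
      reward≥ : local h x i ℤ.≤ local h z i → sum (reward x) ℤ.≤ sum (reward z)
      reward≥ h≥ rewrite split x | split z = ℤ.+-mono-≤ h≥ 2≤deg
      deg≡ : local h x i ℤ.≤ local h z i → deg z ≡ + 2
      deg≡ h≥ with deg z ℤ.≤? deg x
      ... | yes le = trans (ℤ.≤-antisym le 2≤deg) (sum-neighbours₂ at-x)
      ... | no ¬le = ⊥-elim (ℤ.<⇒≱ (ℤ.+-mono-≤-< h≥ (ℤ.≰⇒> ¬le)) total)

  -- Rewarding common edges, charging 1 for edges of exactly one of x, y and 2 for all
  -- others, the minimum degree 2 outside U makes every local sum maximal exactly when
  -- z has at that vertex the neighbours it has in x or in y.
  separating-functional : ∀ {x y} → (∀ i → SameAt x y i ⊎ Moved x y i) →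
    (∀ {z} → InS n U z → (∀ i → SameAt z x i ⊎ SameAt z y i) → SamePt z x ⊎ SamePt z y) →
    ∃[ c ] ((dot c x ≡ dot c y) ×
      ((z : Point n) → InS n U z → ¬ SamePt z x → ¬ SamePt z y → dot c z ℤ.< dot c x))
  separating-functional {x} {y} types only = symmetrized h , balanced , strict
    where
    h = weights x y
    balanced-at : ∀ {i} → SameAt x y i ⊎ Moved x y i → local h x i ≡ local h y i
    balanced-at (inj₁ same) = fixed-balanced same
    balanced-at (inj₂ moved) = moved-balanced moved
    balanced : dot (symmetrized h) x ≡ dot (symmetrized h) y
    balanced = trans (dot-symmetrized h x) (trans (sum-cong-≗ (λ i → balanced-at (types i))) (sym (dot-symmetrized h y)))
    tight : ∀ {z i} → InS n U z → SameAt x y i ⊎ Moved x y i → Tight x y z i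
    tight z∈S (inj₁ same) = fixed-tight same
    tight z∈S (inj₂ moved) = moved-tight moved z∈S
    strict : ∀ z → InS n U z → ¬ SamePt z x → ¬ SamePt z y → dot (symmetrized h) z ℤ.< dot (symmetrized h) x
    strict z z∈S z≉x z≉y rewrite dot-symmetrized h z | dot-symmetrized h x
      with sum (local h x) ℤ.≤? sum (local h z)
    ... | no ≰ = ℤ.≰⇒> ≰
    ... | yes ≥ with only z∈S (λ i → proj₂ (tight z∈S (types i)) (ℤ.≤-reflexive (sym (sum-mono-≤-tight (λ i → proj₁ (tight z∈S (types i))) ≥ i))))
    ...   | inj₁ z≈x = ⊥-elim (z≉x z≈x)
    ...   | inj₂ z≈y = ⊥-elim (z≉y z≈y)

-- Hamiltonian paths

module _ {n : ℕ} {t : Subgraph n} where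

  walk-trans : ∀ {u v w} → Walk t u v → Walk t v w → Walk t u w
  walk-trans here q = q
  walk-trans (step e p) q = step e (walk-trans p q)

  walk-sym : ∀ {u v} → Walk t u v → Walk t v u
  walk-sym here = here
  walk-sym (step {u} {v} e p) = walk-trans (walk-sym p) (step (trans (adj-sym t v u) e) here)

module _ {n : ℕ} (t : Subgraph n) (r : Fin n → ℕ) (root : Fin n)
  (r-adj : ∀ {i j} → adj t i j ≡ true → r i ≢ r j)
  (below-unique : ∀ {i j k} → adj t i j ≡ true → adj t i k ≡ true → r j ℕ.< r i → r k ℕ.< r i → j ≡ k)
  (below : ∀ i → i ≡ root ⊎ (∃[ j ] (adj t i j ≡ true × r j ℕ.< r i))) where

  private
    to-root : ∀ i → Acc ℕ._<_ (r i) → Walk t i root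
    to-root i (acc rec) with below i
    ... | inj₁ refl = here
    ... | inj₂ (j , ij , j<i) = step ij (to-root j (rec j<i))

    -- After an upward step the chain can only keep rising, because a descent from u would give u a
    -- second lower neighbour besides prev. So the lower neighbour w of the last vertex is its
    -- predecessor, which is prev only when u itself is last.
    ascend : ∀ {w} prev u vs → adj t u prev ≡ true → r prev ℕ.< r u → All (prev ≢_) vs → Unique (u ∷ vs) →
      Chain t u vs → adj t (lastOf u vs) w ≡ true →
      r prev ℕ.< r (lastOf u vs) × (r w ℕ.< r (lastOf u vs) → (w ≡ prev × vs ≡ []) ⊎ w ∈ˡ (u ∷ vs))
    ascend prev u [] up p<u _ _ _ uw = p<u , λ w<u → inj₁ (below-unique uw up w<u p<u , refl)
    ascend {w} prev u (v ∷ vs) up p<u (p≢v ∷ _) ((_ ∷ u∉vs) ∷ uniq) (uv , chain) lw with ℕ.<-cmp (r u) (r v)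
    ... | tri≈ _ e _ = ⊥-elim (r-adj uv e)
    ... | tri> _ _ v<u = ⊥-elim (p≢v (below-unique up uv p<u v<u))
    ... | tri< u<v _ _ with ascend u v vs (trans (adj-sym t v u) uv) u<v u∉vs uniq chain lw
    ...   | u<l , k = ℕ.<-trans p<u u<l , λ w<l → inj₂ (visited (k w<l))
      where
      visited : (w ≡ u × vs ≡ []) ⊎ w ∈ˡ (v ∷ vs) → w ∈ˡ (u ∷ v ∷ vs)
      visited (inj₁ (w≡u , _)) = here w≡u
      visited (inj₂ w∈) = there w∈

    -- Downward steps only lower the starting point, so a chain ending above its start must step up
    -- somewhere, and `ascend` takes over there.
    climb : ∀ {w} u vs → Unique (u ∷ vs) → Chain t u vs → r u ℕ.< r (lastOf u vs) →
      adj t (lastOf u vs) w ≡ true → r w ℕ.< r (lastOf u vs) → w ∈ˡ (u ∷ vs)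
    climb u [] _ _ u<u _ _ = ⊥-elim (ℕ.<-irrefl refl u<u)
    climb u (v ∷ vs) ((_ ∷ u∉vs) ∷ uniq) (uv , chain) u<l lw w<l with ℕ.<-cmp (r u) (r v)
    ... | tri≈ _ e _ = ⊥-elim (r-adj uv e)
    ... | tri> _ _ v<u = there (climb v vs uniq chain (ℕ.<-trans v<u u<l) lw w<l)
    ... | tri< u<v _ _ with proj₂ (ascend u v vs (trans (adj-sym t v u) uv) u<v u∉vs uniq chain lw) w<l
    ...   | inj₁ (w≡u , _) = here w≡u
    ...   | inj₂ w∈ = there w∈

    ∉-self : ∀ {A : Set} {v : A} {vs} → All (v ≢_) vs → ¬ (v ∈ˡ vs)
    ∉-self v∉ v∈ = All.lookup v∉ v∈ refl

    last∈ : ∀ {A : Set} (v : A) vs → lastOf v vs ∈ˡ (v ∷ vs)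
    last∈ v [] = here refl
    last∈ v (w ∷ vs) = there (last∈ w vs)

    acyclic : Acyclic t
    acyclic (v ∷ w ∷ x ∷ vs) (_ , (v∉@(_ ∷ v∉xs) ∷ uniq@(w∉ ∷ _)) , (vw , chain) , lv)
      with ℕ.<-cmp (r v) (r w)
    ... | tri≈ _ e _ = r-adj vw e
    ... | tri< v<w _ _ with ascend v w (x ∷ vs) (trans (adj-sym t w v) vw) v<w v∉xs uniq chain lv
    ...   | v<l , k with k v<l
    ...     | inj₂ v∈ = ∉-self v∉ v∈
    acyclic (v ∷ w ∷ x ∷ vs) (_ , (v∉@(_ ∷ v∉xs) ∷ uniq@(w∉ ∷ _)) , (vw , chain) , lv)
        | tri> _ _ w<v with ℕ.<-cmp (r v) (r (lastOf x vs))
    ... | tri≈ _ e _ = r-adj lv (sym e)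
    ... | tri< v<l _ _ = ∉-self v∉ (climb w (x ∷ vs) uniq chain (ℕ.<-trans w<v v<l) lv v<l)
    -- Here v lies above both of its neighbours on the cycle, which would have to coincide.
    ... | tri> _ _ l<v = ∉-self w∉ (subst (_∈ˡ (x ∷ vs)) (below-unique (trans (adj-sym t v (lastOf x vs)) lv) vw l<v w<v) (last∈ x vs))
    acyclic (v ∷ w ∷ []) (s≤s (s≤s ()) , _)
    acyclic (v ∷ []) (s≤s () , _)

  ranked-tree : IsSpanningTree t
  ranked-tree = (λ u v → walk-trans (to-root u (<-wellFounded _)) (walk-sym (to-root v (<-wellFounded _)))) , acyclic

-- ρ is the position on the path, and the constructors say whether the mate comes before or after v.
-- The final vertex is `descending`, with the condition on O vacuous.
data Oriented {V : Set} (M : V → V) (O : V → Maybe V) (ρ : V → ℕ) (root v : V) : Set where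
  descending : ρ (M v) ℕ.< ρ v → (∀ {w} → O v ≡ just w → ρ v ℕ.< ρ w) → Oriented M O ρ root v
  ascending : ρ v ℕ.< ρ (M v) → ∀ {w} → O v ≡ just w → ρ w ℕ.< ρ v → Oriented M O ρ root v
  initial : ρ v ℕ.< ρ (M v) → v ≡ root → O v ≡ nothing → Oriented M O ρ root v

-- A Hamiltonian path: every vertex v but the two ends has exactly the neighbours M v
-- and O v, one of them earlier and the other later on the path in the order of ρ.
record Path (V : Set) : Set where
  field
    M : V → V
    O : V → Maybe V
    ρ : V → ℕ
    root : V

  Nbr : V → V → Set
  Nbr u v = M u ≡ v ⊎ O u ≡ just v

  field
    M-sym : ∀ v → Nbr (M v) v
    O-sym : ∀ {v w} → O v ≡ just w → Nbr w v
    oriented : ∀ v → Oriented M O ρ root v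

  Nbr-sym : ∀ {u v} → Nbr u v → Nbr v u
  Nbr-sym {u} (inj₁ refl) = M-sym u
  Nbr-sym (inj₂ e) = O-sym e

  Nbr-ρ : ∀ {u v} → Nbr u v → ρ u ≢ ρ v
  Nbr-ρ {u} uv e with oriented u | uv
  ... | descending d _ | inj₁ refl = ℕ.<-irrefl (sym e) d
  ... | descending _ o | inj₂ ov = ℕ.<-irrefl e (o ov)
  ... | ascending d _ _ | inj₁ refl = ℕ.<-irrefl e d
  ... | ascending _ ow o | inj₂ ov with refl ← just-injective (trans (sym ow) ov) = ℕ.<-irrefl (sym e) o
  ... | initial d _ _ | inj₁ refl = ℕ.<-irrefl e d
  ... | initial _ _ on | inj₂ ov with () ← trans (sym on) ov

  Nbr-below-unique : ∀ {u v w} → Nbr u v → Nbr u w → ρ v ℕ.< ρ u → ρ w ℕ.< ρ u → v ≡ w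
  Nbr-below-unique (inj₁ refl) (inj₁ refl) _ _ = refl
  Nbr-below-unique (inj₂ e) (inj₂ f) _ _ = just-injective (trans (sym e) f)
  Nbr-below-unique {u} (inj₁ refl) (inj₂ f) v<u w<u with oriented u
  ... | descending _ o = ⊥-elim (ℕ.<-asym (o f) w<u)
  ... | ascending d _ _ = ⊥-elim (ℕ.<-asym d v<u)
  ... | initial d _ _ = ⊥-elim (ℕ.<-asym d v<u)
  Nbr-below-unique {u} (inj₂ e) (inj₁ refl) v<u w<u with oriented u
  ... | descending _ o = ⊥-elim (ℕ.<-asym (o e) v<u)
  ... | ascending d _ _ = ⊥-elim (ℕ.<-asym d w<u)
  ... | initial d _ _ = ⊥-elim (ℕ.<-asym d w<u)

  M≢O : ∀ {v w} → O v ≡ just w → M v ≢ w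
  M≢O {v} ow refl with oriented v
  ... | descending d o = ℕ.<-asym d (o ow)
  ... | ascending d ow' o with refl ← just-injective (trans (sym ow) ow') = ℕ.<-asym d o
  ... | initial _ _ on with () ← trans (sym on) ow

record Enumeration (V : Set) (n : ℕ) : Set where
  field
    enc : V → Fin n
    dec : Fin n → V
    dec-enc : ∀ v → dec (enc v) ≡ v
    enc-dec : ∀ i → enc (dec i) ≡ i

  enc-injective : ∀ {u v} → enc u ≡ enc v → u ≡ v
  enc-injective {u} {v} e = trans (sym (dec-enc u)) (trans (cong dec e) (dec-enc v))

  _≟ⱽ_ : DecidableEquality V
  u ≟ⱽ v = map′ enc-injective (cong enc) (enc u ≟ᶠ enc v)

module PathGraph {V : Set} {n : ℕ} (E : Enumeration V n) (P : Path V) where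
  open Enumeration E
  open Path P

  nbr? : ∀ u v → Dec (Nbr u v)
  nbr? u v = (M u ≟ⱽ v) ⊎-dec ≡-decᵐ _≟ⱽ_ (O u) (just v)

  graph : Subgraph n
  graph ((i , j) , _) = does (nbr? (dec i) (dec j))

  private
    does-yes : ∀ {A : Set} (d : Dec A) → does d ≡ true → A
    does-yes (yes a) _ = a

    does-sym : ∀ u v → does (nbr? u v) ≡ does (nbr? v u)
    does-sym u v = does-⇔ (mk⇔ Nbr-sym Nbr-sym) (nbr? u v) (nbr? v u)

    adj-graph : ∀ i j → adj graph i j ≡ does (nbr? (dec i) (dec j))
    adj-graph i j with <ᶠ-cmp i j
    ... | tri< i<j _ _ = adj-< graph i<j
    ... | tri≈ _ refl _ = trans (adj-irrefl graph i) (sym (dec-false (nbr? (dec i) (dec i)) (λ e → Nbr-ρ e refl)))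
    ... | tri> _ _ j<i = trans (adj-> graph j<i) (does-sym (dec j) (dec i))

  adj-at : ∀ u j → adj graph (enc u) j ≡ does (nbr? u (dec j))
  adj-at u j = trans (adj-graph (enc u) j) (cong (λ v → does (nbr? v (dec j))) (dec-enc u))

  adj⇒Nbr : ∀ {i j} → adj graph i j ≡ true → Nbr (dec i) (dec j)
  adj⇒Nbr {i} {j} e = does-yes (nbr? (dec i) (dec j)) (trans (sym (adj-graph i j)) e)

  enc-adj⇒Nbr : ∀ {u v} → adj graph (enc u) (enc v) ≡ true → Nbr u v
  enc-adj⇒Nbr {u} {v} e = subst₂ Nbr (dec-enc u) (dec-enc v) (adj⇒Nbr {enc u} {enc v} e)

  Nbr⇒adj : ∀ {u v} → Nbr u v → adj graph (enc u) (enc v) ≡ true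
  Nbr⇒adj {u} {v} uv = trans (adj-at u (enc v)) (dec-true (nbr? _ _) (subst (Nbr u) (sym (dec-enc v)) uv))

  ¬Nbr⇒adj : ∀ {u v} → ¬ Nbr u v → adj graph (enc u) (enc v) ≡ false
  ¬Nbr⇒adj {u} {v} ¬uv = trans (adj-at u (enc v)) (dec-false (nbr? _ _) (λ e → ¬uv (subst (Nbr u) (dec-enc v) e)))

  spanningTree : IsSpanningTree graph
  spanningTree = ranked-tree graph (ρ ∘ dec) (enc root)
    (λ e → Nbr-ρ (adj⇒Nbr e))
    (λ ij ik j<i k<i → dec-injective (Nbr-below-unique (adj⇒Nbr ij) (adj⇒Nbr ik) j<i k<i))
    below
    where
    dec-injective : ∀ {i j} → dec i ≡ dec j → i ≡ j
    dec-injective {i} {j} e = trans (sym (enc-dec i)) (trans (cong enc e) (enc-dec j))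
    to : ∀ i {w} → Nbr (dec i) w → ρ w ℕ.< ρ (dec i) → ∃[ j ] (adj graph i j ≡ true × ρ (dec j) ℕ.< ρ (dec i))
    to i {w} iw w<i = enc w , subst (λ k → adj graph k (enc w) ≡ true) (enc-dec i) (Nbr⇒adj iw) ,
      subst (λ x → ρ x ℕ.< ρ (dec i)) (sym (dec-enc w)) w<i
    below : ∀ i → i ≡ enc root ⊎ (∃[ j ] (adj graph i j ≡ true × ρ (dec j) ℕ.< ρ (dec i)))
    below i with oriented (dec i)
    ... | descending d _ = inj₂ (to i (inj₁ refl) d)
    ... | ascending _ ow o = inj₂ (to i (inj₂ ow) o)
    ... | initial _ e _ = inj₁ (trans (sym (enc-dec i)) (cong enc e))

  neighbours₂ : ∀ {v w} → O v ≡ just w → HasNeighbours₂ graph (enc v) (enc (M v)) (enc w)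
  neighbours₂ {v} {w} ow = record
    { a≢p = M≢O ow ∘ enc-injective
    ; adj-a = Nbr⇒adj (inj₁ refl)
    ; adj-p = Nbr⇒adj (inj₂ ow)
    ; adj-rest = rest
    }
    where
    rest : ∀ j → j ≢ enc (M v) → j ≢ enc w → adj graph (enc v) j ≡ false
    rest j j≢M j≢w = subst (λ k → adj graph (enc v) k ≡ false) (enc-dec j) (¬Nbr⇒adj ¬nbr)
      where
      ¬nbr : ¬ Nbr v (dec j)
      ¬nbr (inj₁ e) = j≢M (trans (sym (enc-dec j)) (cong enc (sym e)))
      ¬nbr (inj₂ e) = j≢w (trans (sym (enc-dec j)) (cong enc (sym (just-injective (trans (sym ow) e)))))

  graph∈S : ∀ {U : Subset n} → (∀ v → O v ≡ nothing → enc v ∈ U) → InS n U graph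
  graph∈S {U} ends = graph , spanningTree , leaves , λ _ → refl
    where
    leaves : LeavesIn graph U
    leaves i leaf = subst (_∈ U) (enc-dec i) (go (dec i) (subst (λ k → degree graph k ≡ 1) (sym (enc-dec i)) leaf))
      where
      go : ∀ v → degree graph (enc v) ≡ 1 → enc v ∈ U
      go v leaf with O v in ow
      ... | nothing = ends v ow
      ... | just w with () ← trans (sym leaf) (degree-neighbours₂ (neighbours₂ ow))

-- The paths H b

lower : ∀ {p} → Fin (suc p) → Maybe (Fin p)
lower {zero} zero = nothing
lower {suc p} zero = just zero
lower {suc p} (suc i) = Maybe.map suc (lower i)

lower-inject₁ : ∀ {p} (i : Fin p) → lower (inject₁ i) ≡ just i
lower-inject₁ zero = refl
lower-inject₁ (suc i) rewrite lower-inject₁ i = refl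

lower-just : ∀ {p} (s : Fin (suc p)) {i} → lower s ≡ just i → s ≡ inject₁ i
lower-just {suc p} zero refl = refl
lower-just {suc p} (suc s) e with lower s in eq
lower-just {suc p} (suc s) refl | just i = cong suc (lower-just s eq)

lower-fromℕ : ∀ p → lower (fromℕ p) ≡ nothing
lower-fromℕ zero = refl
lower-fromℕ (suc p) rewrite lower-fromℕ p = refl

lower-nothing : ∀ {p} (s : Fin (suc p)) → lower s ≡ nothing → s ≡ fromℕ p
lower-nothing {zero} zero _ = refl
lower-nothing {suc p} (suc s) e with lower s in eq
lower-nothing {suc p} (suc s) _ | nothing = cong suc (lower-nothing s eq)

prv : ∀ {p} → Fin p → Maybe (Fin p)
prv zero = nothing
prv (suc j) = just (inject₁ j)

nxt : ∀ {p} → Fin p → Maybe (Fin p)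
nxt {suc p} j = Maybe.map suc (lower j)

-- The argument serves as evidence that `Fin p` is inhabited.
first last : ∀ {p} → Fin p → Fin p
first {suc p} _ = zero
last {suc p} _ = fromℕ p

nxt-toℕ : ∀ {p} (j : Fin p) {j'} → nxt j ≡ just j' → toℕ j' ≡ suc (toℕ j)
nxt-toℕ {suc p} j e with lower j in eq
nxt-toℕ {suc p} j refl | just i rewrite lower-just j eq = cong suc (sym (toℕ-inject₁ i))

prv-toℕ : ∀ {p} (j : Fin p) {j'} → prv j ≡ just j' → toℕ j ≡ suc (toℕ j')
prv-toℕ (suc j) refl = cong suc (sym (toℕ-inject₁ j))

prv-nxt : ∀ {p} (j : Fin p) {j'} → prv j ≡ just j' → nxt j' ≡ just j
prv-nxt (suc j) refl rewrite lower-inject₁ j = refl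

nxt-prv : ∀ {p} (j : Fin p) {j'} → nxt j ≡ just j' → prv j' ≡ just j
nxt-prv {suc p} j e with lower j in eq
nxt-prv {suc p} j refl | just i = cong just (sym (lower-just j eq))

prv-first : ∀ {p} (i : Fin p) → prv (first i) ≡ nothing
prv-first {suc p} i = refl

prv-nothing : ∀ {p} (i j : Fin p) → prv j ≡ nothing → j ≡ first i
prv-nothing {suc p} i zero e = refl

nxt-last : ∀ {p} (i : Fin p) → nxt (last i) ≡ nothing
nxt-last {suc p} i rewrite lower-fromℕ p = refl

nxt-nothing : ∀ {p} (i j : Fin p) → nxt j ≡ nothing → j ≡ last i
nxt-nothing {suc p} i j e with lower j in eq
nxt-nothing {suc p} i j refl | nothing = lower-nothing j eq

toℕ-first : ∀ {p} (i : Fin p) → toℕ (first i) ≡ 0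
toℕ-first {suc p} i = refl

toℕ-last : ∀ {p} (i : Fin p) → suc (toℕ (last i)) ≡ p
toℕ-last {suc p} i = cong suc (toℕ-fromℕ p)

xor-false : ∀ {a b} → a xor b ≡ false → a ≡ b
xor-false {true} {true} _ = refl
xor-false {false} {false} _ = refl

pattern outer = false
pattern inner = true

-- The path T 0, S 0, row 0, T 1, S 1, row 1, …, T p, S p, tail.  Row i consists of
-- bundles j = 0, 1, …, each with four corners (k , l) ∈ Bool², and each corner is an
-- edge joining an outer vertex, linked inside row i, to an inner one, linked to bundle
-- (j , i).  A bit word b fixes the path: it enters bundle (i , j) at the corner
-- (false , b i) and leaves it at (true , b i), and the other two corners are linked to
-- each other.
data Vertex (p r : ℕ) : Set where
  cor : (i j : Fin p) (k l t : Bool) → Vertex p r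
  S T : (s : Fin (suc p)) → Vertex p r
  tail : (q : Fin (suc r)) → Vertex p r

-- Where corner (k , l) of bundle (i , j) is joined to in bundle (j , i), in terms of
-- e = b i xor b j.  For e = false the partners lie on opposite diagonals l, for
-- e = true on equal ones, and the alternating cycle of the two matchings is an 8-cycle.
partnerₖ : (e k l : Bool) → Bool
partnerₖ e k l = k xor (e ∧ l)

partnerₗ : (e l : Bool) → Bool
partnerₗ e l = not (e xor l)

-- A visit to bundle (i , j) has 8 vertices: in through one own corner at 0, 1, across to the linked
-- corners of (j , i) at 2 to 5, and back out through the other own corner at 6, 7.
offsetOwn offsetLink : (k t : Bool) → ℕ
offsetOwn false outer = 0
offsetOwn false inner = 1
offsetOwn true inner = 6
offsetOwn true outer = 7
offsetLink false inner = 2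
offsetLink false outer = 3
offsetLink true outer = 4
offsetLink true inner = 5

-- The position of a vertex of bundle (i , j) for b i = β, b j = γ, where the visits
-- to bundles (i , j) and (j , i) start at B and B'.  The linked corners of (i , j) are
-- reached only during the visit to (j , i).
place : (β γ : Bool) (B B' : ℕ) (k l t : Bool) → ℕ
place β γ B B' k l t = if l xor β then B' + offsetLink (k xor (l ∧ γ)) t else B + offsetOwn k t

<-offset : ∀ B x y {_ : Bool.T (x <ᵇ y)} → B + x ℕ.< B + y
<-offset B x y {x<y} = ℕ.+-monoʳ-< B (ℕ.<ᵇ⇒< x y x<y)

-- Of two inner vertices wired together exactly one lies on the own diagonal of its bundle, so both
-- belong to the same visit and only offsets from one base are compared.
inner-place : ∀ β γ B B' k l →
  let here = place β γ B B' k l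
      there = place γ β B' B (partnerₖ (β xor γ) k l) (partnerₗ (β xor γ) l) inner
  in (here outer ℕ.< here inner × here inner ℕ.< there) ⊎ (here inner ℕ.< here outer × there ℕ.< here inner)
inner-place false false B B' false false = inj₁ (<-offset B 0 1 , <-offset B 1 2)
inner-place false false B B' false true = inj₂ (<-offset B' 2 3 , <-offset B' 1 2)
inner-place false false B B' true false = inj₂ (<-offset B 6 7 , <-offset B 5 6)
inner-place false false B B' true true = inj₁ (<-offset B' 4 5 , <-offset B' 5 6)
inner-place false true B B' false false = inj₁ (<-offset B 0 1 , <-offset B 1 2)
inner-place false true B B' false true = inj₁ (<-offset B' 4 5 , <-offset B' 5 6)
inner-place false true B B' true false = inj₂ (<-offset B 6 7 , <-offset B 5 6)
inner-place false true B B' true true = inj₂ (<-offset B' 2 3 , <-offset B' 1 2)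
inner-place true false B B' false false = inj₂ (<-offset B' 2 3 , <-offset B' 1 2)
inner-place true false B B' false true = inj₁ (<-offset B 0 1 , <-offset B 1 2)
inner-place true false B B' true false = inj₁ (<-offset B' 4 5 , <-offset B' 5 6)
inner-place true false B B' true true = inj₂ (<-offset B 6 7 , <-offset B 5 6)
inner-place true true B B' false false = inj₂ (<-offset B' 2 3 , <-offset B' 1 2)
inner-place true true B B' false true = inj₁ (<-offset B 0 1 , <-offset B 1 2)
inner-place true true B B' true false = inj₁ (<-offset B' 4 5 , <-offset B' 5 6)
inner-place true true B B' true true = inj₂ (<-offset B 6 7 , <-offset B 5 6)

link-place : ∀ B k c →
  let here = B + offsetLink (k xor c) outer
      inside = B + offsetLink (k xor c) inner
      there = B + offsetLink (not k xor c) outer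
  in (inside ℕ.< here × here ℕ.< there) ⊎ (here ℕ.< inside × there ℕ.< here)
link-place B false false = inj₁ (<-offset B 2 3 , <-offset B 3 4)
link-place B false true = inj₂ (<-offset B 4 5 , <-offset B 3 4)
link-place B true false = inj₂ (<-offset B 4 5 , <-offset B 3 4)
link-place B true true = inj₁ (<-offset B 2 3 , <-offset B 3 4)

module _ {p r : ℕ} where

  private
    V : Set
    V = Vertex p r
    -- The positions taken by one row: T i, S i and p visits of 8 vertices each.
    W : ℕ
    W = 2 + p * 8

  base : (i j : Fin p) → ℕ
  base i j = toℕ i * W + (2 + toℕ j * 8)

  beyond : (i j : Fin p) (k l : Bool) → V
  beyond i j false l = maybe (λ j' → cor i j' true l outer) (S (inject₁ i)) (prv j)
  beyond i j true l = maybe (λ j' → cor i j' false l outer) (T (suc i)) (nxt j)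

  mate : V → V
  mate (cor i j k l t) = cor i j k l (not t)
  mate (S s) = T s
  mate (T s) = S s
  mate (tail q) = maybe tail (S (fromℕ p)) (prv q)

  other : (Fin p → Bool) → V → Maybe V
  -- `l xor b i` is true on the linked diagonal and false on the own one.
  other b (cor i j k l outer) = just (if l xor b i then cor i j (not k) l outer else beyond i j k l)
  other b (cor i j k l inner) = just (cor j i (partnerₖ (b i xor b j) k l) (partnerₗ (b i xor b j) l) inner)
  other b (S s) = just (maybe (λ i → cor i (first i) false (b i) outer) (tail zero) (lower s))
  other b (T zero) = nothing
  other b (T (suc i)) = just (cor i (last i) true (b i) outer)
  other b (tail q) = Maybe.map tail (nxt q)

  rank : (Fin p → Bool) → V → ℕ
  rank b (cor i j k l t) = place (b i) (b j) (base i j) (base j i) k l t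
  rank b (S s) = toℕ s * W + 1
  rank b (T s) = toℕ s * W + 0
  rank b (tail q) = p * W + (2 + toℕ q)

  mate-sym : ∀ b v → mate (mate v) ≡ v ⊎ other b (mate v) ≡ just v
  mate-sym b (cor i j k l t) = inj₁ (cong (cor i j k l) (not-involutive t))
  mate-sym b (S s) = inj₁ refl
  mate-sym b (T s) = inj₁ refl
  mate-sym b (tail zero) rewrite lower-fromℕ p = inj₂ refl
  mate-sym b (tail (suc q)) rewrite lower-inject₁ q = inj₂ refl

  other-sym : ∀ b {v w} → other b v ≡ just w → mate w ≡ v ⊎ other b w ≡ just v
  other-sym b {cor i j k l outer} refl with l xor b i in own
  ... | true rewrite own = inj₂ (cong (λ k → just (cor i j k l outer)) (not-involutive k))
  other-sym b {cor i j false l outer} refl | false with prv j in eq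
  ... | nothing rewrite lower-inject₁ i = inj₂ (cong₂ (λ j l → just (cor i j false l outer))
    (sym (prv-nothing i j eq)) (sym (xor-false own)))
  ... | just j' rewrite own | prv-nxt j eq = inj₂ refl
  other-sym b {cor i j true l outer} refl | false with nxt j in eq
  ... | nothing = inj₂ (cong₂ (λ j l → just (cor i j true l outer))
    (sym (nxt-nothing i j eq)) (sym (xor-false own)))
  ... | just j' rewrite own | nxt-prv j eq = inj₂ refl
  -- Both bundles see the same e, as xor is symmetric, and for fixed e the wiring is an involution.
  other-sym b {cor i j k l inner} refl rewrite xor-comm (b j) (b i) =
    inj₂ (cong₂ (λ k l → just (cor i j k l inner)) (k≡ (b i xor b j) k l) (l≡ (b i xor b j) l))
    where
    k≡ : ∀ e k l → partnerₖ e (partnerₖ e k l) (partnerₗ e l) ≡ k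
    k≡ false false l = refl
    k≡ false true l = refl
    k≡ true false false = refl
    k≡ true false true = refl
    k≡ true true false = refl
    k≡ true true true = refl
    l≡ : ∀ e l → partnerₗ e (partnerₗ e l) ≡ l
    l≡ false false = refl
    l≡ false true = refl
    l≡ true false = refl
    l≡ true true = refl
  other-sym b {S s} refl with lower s in eq
  ... | nothing rewrite lower-nothing s eq = inj₁ refl
  ... | just i rewrite xor-same (b i) | prv-first i | lower-just s eq = inj₂ refl
  other-sym b {T (suc i)} refl rewrite xor-same (b i) | nxt-last i = inj₂ refl
  other-sym b {tail q} e with nxt q in eq
  other-sym b {tail q} refl | just q' rewrite nxt-prv q eq = inj₁ refl

  before-row : ∀ i → toℕ (inject₁ i) * W + 1 ℕ.< base i (first i) + 0
  before-row i rewrite toℕ-inject₁ i | toℕ-first i | ℕ.+-identityʳ (toℕ i * W + 2) = <-offset (toℕ i * W) 1 2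

  after-row : ∀ i → base i (last i) + 7 ℕ.< toℕ (suc i) * W + 0
  after-row i = ℕ.≤-reflexive (trans (eq (toℕ i) W (toℕ (last i)))
    (cong (λ m → 2 + m * 8 + toℕ i * W + 0) (toℕ-last i)))
    where
    open +-*-Solver
    eq : ∀ x w l → suc (x * w + (2 + l * 8) + 7) ≡ 2 + suc l * 8 + x * w + 0
    eq = solve 3 (λ x w l → con 1 :+ (x :* w :+ (con 2 :+ l :* con 8) :+ con 7) :=
      con 2 :+ (con 1 :+ l) :* con 8 :+ x :* w :+ con 0) refl

  next-bundle : ∀ i {j j'} → toℕ j' ≡ suc (toℕ j) → base i j + 7 ℕ.< base i j' + 0
  next-bundle i {j} {j'} e rewrite e = ℕ.≤-reflexive (eq (toℕ i * W) (toℕ j))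
    where
    open +-*-Solver
    eq : ∀ x l → suc (x + (2 + l * 8) + 7) ≡ x + (2 + suc l * 8) + 0
    eq = solve 2 (λ x l → con 1 :+ (x :+ (con 2 :+ l :* con 8) :+ con 7) :=
      x :+ (con 2 :+ (con 1 :+ l) :* con 8) :+ con 0) refl

  rank-own : ∀ b i j k l t → l xor b i ≡ false → rank b (cor i j k l t) ≡ base i j + offsetOwn k t
  rank-own b i j k l t own rewrite own = refl

  rank-link : ∀ b i j k l t → l xor b i ≡ true → rank b (cor i j k l t) ≡ base j i + offsetLink (k xor (l ∧ b j)) t
  rank-link b i j k l t link rewrite link = refl

  other-own : ∀ b i j k l → l xor b i ≡ false → other b (cor i j k l outer) ≡ just (beyond i j k l)
  other-own b i j k l own rewrite own = refl

  other-link : ∀ b i j k l → l xor b i ≡ true → other b (cor i j k l outer) ≡ just (cor i j (not k) l outer)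
  other-link b i j k l link rewrite link = refl

  oriented : ∀ b v → Oriented mate (other b) (rank b) (T zero) v
  oriented b (cor i j k l inner)
    with inner-place (b i) (b j) (base i j) (base j i) k l
  ... | inj₁ (d , o) = descending d (λ { refl → o })
  ... | inj₂ (d , o) = ascending d refl o
  oriented b (cor i j k l outer) with l xor b i in own
  oriented b (cor i j k l outer) | true with link-place (base j i) k (l ∧ b j)
  ... | inj₁ (d , o) = descending
    (subst₂ ℕ._<_ (sym (rank-link b i j k l inner own)) (sym (rank-link b i j k l outer own)) d)
    (λ e → subst₂ ℕ._<_ (sym (rank-link b i j k l outer own))
      (trans (sym (rank-link b i j (not k) l outer own)) (cong (rank b) (just-injective (trans (sym (other-link b i j k l own)) e)))) o)
  ... | inj₂ (d , o) = ascending
    (subst₂ ℕ._<_ (sym (rank-link b i j k l outer own)) (sym (rank-link b i j k l inner own)) d)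
    (other-link b i j k l own)
    (subst₂ ℕ._<_ (sym (rank-link b i j (not k) l outer own)) (sym (rank-link b i j k l outer own)) o)
  oriented b (cor i j false l outer) | false = ascending
    (subst₂ ℕ._<_ (sym (rank-own b i j false l outer own)) (sym (rank-own b i j false l inner own)) (<-offset (base i j) 0 1))
    (other-own b i j false l own)
    (subst (rank b (beyond i j false l) ℕ.<_) (sym (rank-own b i j false l outer own)) entry)
    where
    entry : rank b (beyond i j false l) ℕ.< base i j + 0
    entry with prv j in eq
    ... | nothing rewrite prv-nothing i j eq = before-row i
    ... | just j' rewrite rank-own b i j' true l outer own = next-bundle i (prv-toℕ j eq)
  oriented b (cor i j true l outer) | false = descending
    (subst₂ ℕ._<_ (sym (rank-own b i j true l inner own)) (sym (rank-own b i j true l outer own)) (<-offset (base i j) 6 7))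
    (λ e → subst₂ ℕ._<_ (sym (rank-own b i j true l outer own))
      (cong (rank b) (just-injective (trans (sym (other-own b i j true l own)) e))) exit)
    where
    exit : base i j + 7 ℕ.< rank b (beyond i j true l)
    exit with nxt j in eq
    ... | nothing rewrite nxt-nothing i j eq = after-row i
    ... | just j' rewrite rank-own b i j' false l outer own = next-bundle i (nxt-toℕ j eq)
  oriented b (S s) = descending (<-offset (toℕ s * W) 0 1) (λ { refl → go })
    where
    go : toℕ s * W + 1 ℕ.< rank b (maybe (λ i → cor i (first i) false (b i) outer) (tail zero) (lower s))
    go with lower s in eq
    ... | nothing rewrite lower-nothing s eq | toℕ-fromℕ p = <-offset (p * W) 1 2
    ... | just i rewrite lower-just s eq | rank-own b i (first i) false (b i) outer (xor-same (b i)) = before-row i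
  oriented b (T zero) = initial (s≤s z≤n) refl refl
  oriented b (T (suc i)) = ascending (<-offset (toℕ (suc i) * W) 0 1) refl
    (subst (ℕ._< toℕ (suc i) * W + 0) (sym (rank-own b i (last i) true (b i) outer (xor-same (b i)))) (after-row i))
  oriented b (tail q) = descending before after
    where
    before : rank b (mate (tail q)) ℕ.< rank b (tail q)
    before with prv q in eq
    ... | nothing rewrite toℕ-fromℕ p = ℕ.+-monoʳ-< (p * W) (s≤s (s≤s z≤n))
    ... | just q' rewrite prv-toℕ q eq = ℕ.+-monoʳ-< (p * W) ℕ.≤-refl
    after : ∀ {w} → Maybe.map tail (nxt q) ≡ just w → rank b (tail q) ℕ.< rank b w
    after e with nxt q in eq
    after refl | just q' rewrite nxt-toℕ q eq = ℕ.+-monoʳ-< (p * W) ℕ.≤-refl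

  path : (Fin p → Bool) → Path V
  path b = record
    { M = mate
    ; O = other b
    ; ρ = rank b
    ; root = T zero
    ; M-sym = mate-sym b
    ; O-sym = λ {v} → other-sym b {v}
    ; oriented = oriented b
    }

-- Trees between two of the paths

≢⇒≡not : ∀ {a b} → a ≢ b → b ≡ not a
≢⇒≡not {true} {true} a≢b = ⊥-elim (a≢b refl)
≢⇒≡not {true} {false} _ = refl
≢⇒≡not {false} {true} _ = refl
≢⇒≡not {false} {false} a≢b = ⊥-elim (a≢b refl)

module Words {p r n : ℕ} (E : Enumeration (Vertex p r) n) where
  open Enumeration E

  V : Set
  V = Vertex p r

  Word : Set
  Word = Fin p → Bool

  point : Word → Point n
  point c = PathGraph.graph E (path c)

  _∼[_]_ : V → Word → V → Set
  u ∼[ c ] v = Path.Nbr (path c) u v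

  point-≡ : ∀ {c c' v} → other c v ≡ other c' v → SameAt (point c) (point c') (enc v)
  point-≡ {c} {c'} {v} e j = trans (PathGraph.adj-at E (path c) v j)
    (trans (does-⇔ (mk⇔ (go e) (go (sym e))) (PathGraph.nbr? E (path c) v (dec j)) (PathGraph.nbr? E (path c') v (dec j)))
      (sym (PathGraph.adj-at E (path c') v j)))
    where
    go : ∀ {c c'} → other c v ≡ other c' v → v ∼[ c ] dec j → v ∼[ c' ] dec j
    go e (inj₁ m) = inj₁ m
    go e (inj₂ o) = inj₂ (trans (sym e) o)

  beyond-≢ : ∀ i j k l → beyond {p} {r} i j k l ≢ cor i j (not k) l outer
  beyond-≢ i j false l e with prv j in eq
  beyond-≢ i j false l refl | just _ = ℕ.1+n≢n (sym (prv-toℕ j eq))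
  beyond-≢ i j true l e with nxt j in eq
  beyond-≢ i j true l refl | just _ = ℕ.1+n≢n (sym (nxt-toℕ j eq))

  module _ (z : Point n) where

    Agrees : Word → V → Set
    Agrees c v = SameAt z (point c) (enc v)

    Edge-z : V → V → Set
    Edge-z u v = adj z (enc u) (enc v) ≡ true

    Edge-z-sym : ∀ {u v} → Edge-z u v → Edge-z v u
    Edge-z-sym {u} {v} e = trans (adj-sym z (enc v) (enc u)) e

    edge : ∀ c {u v} → Agrees c u → u ∼[ c ] v → Edge-z u v
    edge c {u} {v} ag uv = trans (ag (enc v)) (PathGraph.Nbr⇒adj E (path c) {u} {v} uv)

    edge⁻¹ : ∀ c {u v} → Agrees c u → Edge-z u v → u ∼[ c ] v
    edge⁻¹ c {u} {v} ag uv = PathGraph.enc-adj⇒Nbr E (path c) {u} {v} (trans (sym (ag (enc v))) uv)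

    -- If an edge uv lies in exactly one of the two paths, its presence in z tells which path z
    -- follows at u, and likewise at v.
    transfer : ∀ c c' {u v} → (∀ v → Agrees c v ⊎ Agrees c' v) →
      (u ∼[ c ] v × ¬ (u ∼[ c' ] v)) ⊎ (u ∼[ c' ] v × ¬ (u ∼[ c ] v)) → Agrees c u → Agrees c v
    transfer c c' {u} {v} agree differ ag with agree v
    ... | inj₁ ag-v = ag-v
    ... | inj₂ ag'-v with differ
    ...   | inj₁ (uv , ¬uv) = ⊥-elim (¬uv (Path.Nbr-sym (path c') (edge⁻¹ c' ag'-v (Edge-z-sym {u} {v} (edge c ag uv)))))
    ...   | inj₂ (uv , ¬uv) = ⊥-elim (¬uv (edge⁻¹ c ag (Edge-z-sym {v} {u} (edge c' ag'-v (Path.Nbr-sym (path c') uv)))))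

    -- The mate of u is the same in both paths, so each of the edges uv and uv' lies in one path
    -- only and `transfer` applies along both.
    spread : ∀ c c' {u v v'} → (∀ v → Agrees c v ⊎ Agrees c' v) →
      other c u ≡ just v → other c' u ≡ just v' → v ≢ v' → Agrees c u → Agrees c v × Agrees c v'
    spread c c' {u} {v} {v'} agree uv uv' v≢v' ag =
      transfer c c' agree (inj₁ (inj₂ uv , ¬uv)) ag , transfer c c' agree (inj₂ (inj₂ uv' , ¬uv')) ag
      where
      ¬uv : ¬ (u ∼[ c' ] v)
      ¬uv (inj₁ m) = Path.M≢O (path c) {u} uv m
      ¬uv (inj₂ o) = v≢v' (just-injective (trans (sym o) uv'))
      ¬uv' : ¬ (u ∼[ c ] v')
      ¬uv' (inj₁ m) = Path.M≢O (path c') {u} uv' m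
      ¬uv' (inj₂ o) = v≢v' (just-injective (trans (sym uv) o))

    agrees-≡ : ∀ c c' {v} → other c v ≡ other c' v → Agrees c v ⊎ Agrees c' v → Agrees c v
    agrees-≡ c c' e (inj₁ ag) = ag
    agrees-≡ c c' {v} e (inj₂ ag') j = trans (ag' j) (point-≡ {c'} {c} {v} (sym e) j)

    -- Flipping c i exchanges own and linked diagonal: at any outer corner one path stays inside the
    -- bundle and the other leaves it, so agreement passes both ways.
    row-spread : ∀ c c' → (∀ v → Agrees c v ⊎ Agrees c' v) → ∀ {i} → c i ≢ c' i → ∀ {j k l} →
      Agrees c (cor i j k l outer) → Agrees c (cor i j (not k) l outer) × Agrees c (beyond i j k l)
    row-spread c c' agree {i} ci≢ {j} {k} {l} ag with l xor c i in e
    ... | true = spread c c' agree (other-link c i j k l e) (other-own c' i j k l e')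
      (beyond-≢ i j k l ∘ sym) ag
      where
      e' : l xor c' i ≡ false
      e' rewrite ≢⇒≡not ci≢ | sym (not-distribʳ-xor l (c i)) | e = refl
    ... | false with spread c c' agree (other-own c i j k l e) (other-link c' i j k l e') (beyond-≢ i j k l) ag
      where
      e' : l xor c' i ≡ true
      e' rewrite ≢⇒≡not ci≢ | sym (not-distribʳ-xor l (c i)) | e = refl
    ...   | beyond-ag , link-ag = link-ag , beyond-ag

    -- The two paths leave S i towards opposite diagonals of the first bundle. Agreement thus enters
    -- on both diagonals and moves through the row bundle by bundle.
    row : ∀ c c' → (∀ v → Agrees c v ⊎ Agrees c' v) → ∀ {i} → c i ≢ c' i → Agrees c (S (inject₁ i)) →
      ∀ j k l → Agrees c (cor i j k l outer)
    row c c' agree {i} ci≢ agS j k l = both (go (toℕ j) j refl) k l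
      where
      both : ∀ {j} → (∀ l → Agrees c (cor i j false l outer)) → ∀ k l → Agrees c (cor i j k l outer)
      both ag false l = ag l
      both ag true l = proj₁ (row-spread c c' agree ci≢ (ag l))
      start : Agrees c (cor i (first i) false (c i) outer) × Agrees c (cor i (first i) false (c' i) outer)
      start = spread c c' agree (S-other c) (S-other c') (λ { e → ci≢ (l-injective e) }) agS
        where
        S-other : ∀ c → other {p} {r} c (S (inject₁ i)) ≡ just (cor i (first i) false (c i) outer)
        S-other c rewrite lower-inject₁ i = refl
        l-injective : ∀ {j k l l' t} → cor {p} {r} i j k l t ≡ cor i j k l' t → l ≡ l'
        l-injective refl = refl
      pick : ∀ l → l ≡ c i ⊎ l ≡ c' i
      pick l with l ≟ᵇ c i
      ... | yes e = inj₁ e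
      ... | no l≢ = inj₂ (trans (≢⇒≡not (l≢ ∘ sym)) (sym (≢⇒≡not ci≢)))
      go : ∀ m j → toℕ j ≡ m → ∀ l → Agrees c (cor i j false l outer)
      go m j jm l with prv j in eq
      go m j jm l | nothing rewrite prv-nothing i j eq with pick l
      ... | inj₁ refl = proj₁ start
      ... | inj₂ refl = proj₂ start
      go zero j jm l | just j' with () ← trans (sym jm) (prv-toℕ j eq)
      go (suc m) j jm l | just j' = subst (Agrees c) beyond-j'
        (proj₂ (row-spread c c' agree ci≢ (proj₁ (row-spread c c' agree ci≢ (go m j' (ℕ.suc-injective (trans (sym (prv-toℕ j eq)) jm)) l)))))
        where
        beyond-j' : beyond i j' true l ≡ cor i j false l outer
        beyond-j' rewrite prv-nxt j eq = refl

    -- A wiring that matches a linked diagonal of (i , j) with a linked diagonal of (j , i) closes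
    -- up at once: two link edges, two cross edges and four mates.
    no-cycle : Acyclic z → (∀ v → Edge-z v (mate v)) → ∀ {i j} → i ≢ j → ∀ e l →
      Edge-z (cor i j false l outer) (cor i j true l outer) →
      (∀ k → Edge-z (cor j i k (partnerₗ e l) outer) (cor j i (not k) (partnerₗ e l) outer)) →
      (∀ k → Edge-z (cor i j k l inner) (cor j i (partnerₖ e k l) (partnerₗ e l) inner)) → ⊥
    no-cycle acyclic mates {i} {j} i≢j e l link link' across = acyclic (map enc (cycle k l'))
      ( s≤s (s≤s (s≤s z≤n))
      , map⁺ enc-injective (distinct k l')
      , ( link , mates (cor i j true l outer) , across true , mates (cor j i (not k) l' inner)
        , Edge-z-sym {cor j i k l' outer} {cor j i (not k) l' outer} (link' k) , mates (cor j i k l' outer)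
        , Edge-z-sym {cor i j false l inner} {cor j i k l' inner} (across false) , _ )
      , mates (cor i j false l inner) )
      where
      k = e ∧ l
      l' = partnerₗ e l
      cycle : (k l' : Bool) → List V
      cycle k l' =
        cor i j false l outer ∷ cor i j true l outer ∷ cor i j true l inner ∷
        cor j i (not k) l' inner ∷ cor j i (not k) l' outer ∷
        cor j i k l' outer ∷ cor j i k l' inner ∷ cor i j false l inner ∷ []
      crossed : ∀ {a b k l t k' l' t'} → a ≢ b → cor {p} {r} a b k l t ≢ cor b a k' l' t'
      crossed a≢b refl = a≢b refl
      -- Fixing k lets the corners k and not k be separated by absurd patterns. Vertices of
      -- different bundles are separated by i ≢ j.
      distinct : ∀ k l' → Unique (cycle k l')
      distinct false l' =
        ((λ ()) ∷ (λ ()) ∷ crossed i≢j ∷ crossed i≢j ∷ crossed i≢j ∷ crossed i≢j ∷ (λ ()) ∷ [])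
          ∷ ((λ ()) ∷ crossed i≢j ∷ crossed i≢j ∷ crossed i≢j ∷ crossed i≢j ∷ (λ ()) ∷ [])
          ∷ (crossed i≢j ∷ crossed i≢j ∷ crossed i≢j ∷ crossed i≢j ∷ (λ ()) ∷ [])
          ∷ ((λ ()) ∷ (λ ()) ∷ (λ ()) ∷ crossed (i≢j ∘ sym) ∷ [])
          ∷ ((λ ()) ∷ (λ ()) ∷ crossed (i≢j ∘ sym) ∷ [])
          ∷ ((λ ()) ∷ crossed (i≢j ∘ sym) ∷ [])
          ∷ (crossed (i≢j ∘ sym) ∷ [])
          ∷ [] ∷ []
      distinct true l' =
        ((λ ()) ∷ (λ ()) ∷ crossed i≢j ∷ crossed i≢j ∷ crossed i≢j ∷ crossed i≢j ∷ (λ ()) ∷ [])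
          ∷ ((λ ()) ∷ crossed i≢j ∷ crossed i≢j ∷ crossed i≢j ∷ crossed i≢j ∷ (λ ()) ∷ [])
          ∷ (crossed i≢j ∷ crossed i≢j ∷ crossed i≢j ∷ crossed i≢j ∷ (λ ()) ∷ [])
          ∷ ((λ ()) ∷ (λ ()) ∷ (λ ()) ∷ crossed (i≢j ∘ sym) ∷ [])
          ∷ ((λ ()) ∷ (λ ()) ∷ crossed (i≢j ∘ sym) ∷ [])
          ∷ ((λ ()) ∷ crossed (i≢j ∘ sym) ∷ [])
          ∷ (crossed (i≢j ∘ sym) ∷ [])
          ∷ [] ∷ []

    module _ (acyclic : Acyclic z) (c c' : Word) (agree : ∀ v → Agrees c v ⊎ Agrees c' v) where

      mates : ∀ v → Edge-z v (mate v)
      mates v with agree v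
      ... | inj₁ ag = edge c ag (inj₁ refl)
      ... | inj₂ ag' = edge c' ag' (inj₁ refl)

      link-edge : ∀ d {i j} k → Agrees d (cor i j k (not (d i)) outer) →
        Edge-z (cor i j k (not (d i)) outer) (cor i j (not k) (not (d i)) outer)
      link-edge d {i} {j} k ag = edge d ag (inj₂ (other-link d i j k (not (d i)) (xor-inverseˡ (d i))))

      other-inner : ∀ {i j} k l → c i xor c j ≡ c' i xor c' j → other {p} {r} c (cor i j k l inner) ≡ other c' (cor i j k l inner)
      other-inner k l e rewrite e = refl

      rows-together : ∀ {i j} → c i ≢ c' i → c j ≢ c' j → Agrees c (S (inject₁ i)) → Agrees c (S (inject₁ j))
      rows-together {i} {j} ci≢ cj≢ agS with i ≟ᶠ j
      ... | yes refl = agS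
      ... | no i≢j with agree (S (inject₁ j))
      ...   | inj₁ ag = ag
      ...   | inj₂ ag' = ⊥-elim (no-cycle acyclic mates i≢j (c i xor c j) (not (c i))
        (link-edge c false (row c c' agree ci≢ agS j false (not (c i))))
        (λ k → subst (λ l → Edge-z (cor j i k l outer) (cor j i (not k) l outer)) (sym l≡)
          (link-edge c' k (row c' c (swap ∘ agree) (cj≢ ∘ sym) ag' i k (not (c' j)))))
        (λ k → edge c (agrees-≡ c c' (other-inner k (not (c i)) xor≡) (agree (cor i j k (not (c i)) inner))) (inj₂ refl)))
        where
        -- The common wiring sends the linked diagonal of row i under c to c j, which is the own
        -- diagonal of row j under c but the linked one under c'.
        l≡ : partnerₗ (c i xor c j) (not (c i)) ≡ not (c' j)
        l≡ rewrite ≢⇒≡not cj≢ with c i | c j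
        ... | true | true = refl
        ... | true | false = refl
        ... | false | true = refl
        ... | false | false = refl
        xor≡ : c i xor c j ≡ c' i xor c' j
        xor≡ rewrite ≢⇒≡not ci≢ | ≢⇒≡not cj≢ with c i | c j
        ... | true | true = refl
        ... | true | false = refl
        ... | false | true = refl
        ... | false | false = refl

      module _ (starts : ∀ i → c i ≢ c' i → Agrees c (S (inject₁ i))) where

        agrees-outer : ∀ i j k l → Agrees c (cor i j k l outer)
        agrees-outer i j k l with c i ≟ᵇ c' i
        ... | no ci≢ = row c c' agree ci≢ (starts i ci≢) j k l
        ... | yes ci≡ = agrees-≡ c c' other≡ (agree (cor i j k l outer))
          where
          other≡ : other {p} {r} c (cor i j k l outer) ≡ other c' (cor i j k l outer)
          other≡ rewrite ci≡ = refl

        agrees-T : ∀ s → Agrees c (T s)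
        agrees-T zero = agrees-≡ c c' refl (agree (T zero))
        agrees-T (suc i) with c i ≟ᵇ c' i
        ... | yes ci≡ = agrees-≡ c c' (cong (λ l → just (cor i (last i) true l outer)) ci≡) (agree (T (suc i)))
        ... | no ci≢ = subst (Agrees c) beyond-last (proj₂ (row-spread c c' agree ci≢ (row c c' agree ci≢ (starts i ci≢) (last i) true true)))
          where
          beyond-last : beyond i (last i) true true ≡ T (suc i)
          beyond-last rewrite nxt-last i = refl

        agrees-S : ∀ s → Agrees c (S s)
        agrees-S s with lower s in eq
        ... | nothing = agrees-≡ c c' other≡ (agree (S s))
          where
          other≡ : other {p} {r} c (S s) ≡ other c' (S s)
          other≡ rewrite eq = refl
        ... | just i rewrite lower-just s eq with c i ≟ᵇ c' i
        ...   | no ci≢ = starts i ci≢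
        ...   | yes ci≡ = agrees-≡ c c' other≡ (agree (S (inject₁ i)))
          where
          other≡ : other {p} {r} c (S (inject₁ i)) ≡ other c' (S (inject₁ i))
          other≡ rewrite lower-inject₁ i | ci≡ = refl

        -- The wirings differ only if exactly one of the rows i, j flips. A single inner vertex
        -- following c' then draws in the whole alternating 8-cycle of the two wirings, so z has the
        -- full wiring of c' between rows that follow c, and this joins linked diagonals.
        agrees-inner : ∀ i j k l → Agrees c (cor i j k l inner)
        agrees-inner i j k l with agree (cor i j k l inner) | (c i xor c j) ≟ᵇ (c' i xor c' j)
        ... | inj₁ ag | _ = ag
        ... | inj₂ ag' | yes e = agrees-≡ c c' (other-inner k l e) (inj₂ ag')
        ... | inj₂ ag' | no e≢ = ⊥-elim (no-cycle acyclic mates i≢j (c' i xor c' j) (not (c i))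
          (link-edge c false (agrees-outer i j false (not (c i))))
          (λ k → subst (λ l → Edge-z (cor j i k l outer) (cor j i (not k) l outer)) (sym l≡)
            (link-edge c k (agrees-outer j i k (not (c j)))))
          (λ k' → edge c' (everywhere k l ag' k' (not (c i))) (inj₂ refl)))
          where
          i≢j : i ≢ j
          i≢j refl = e≢ (trans (xor-same (c i)) (sym (xor-same (c' i))))
          l≡ : partnerₗ (c' i xor c' j) (not (c i)) ≡ not (c j)
          l≡ rewrite ≢⇒≡not e≢ with c i | c j
          ... | true | true = refl
          ... | true | false = refl
          ... | false | true = refl
          ... | false | false = refl
          across : ∀ {i j} → (c i xor c j) ≢ (c' i xor c' j) → ∀ {k l} → Agrees c' (cor i j k l inner) →
            Agrees c' (cor j i (partnerₖ (c' i xor c' j) k l) (partnerₗ (c' i xor c' j) l) inner) ×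
            Agrees c' (cor j i (partnerₖ (c i xor c j) k l) (partnerₗ (c i xor c j) l) inner)
          across {i} {j} e≢ {k} {l} = spread c' c (swap ∘ agree) refl refl
            (λ e → e≢ (sym (l-injective _ _ k l e)))
            where
            l-injective : ∀ a b k l → cor {p} {r} j i (partnerₖ a k l) (partnerₗ a l) inner ≡ cor j i (partnerₖ b k l) (partnerₗ b l) inner → a ≡ b
            l-injective true true _ _ _ = refl
            l-injective false false _ _ _ = refl
            l-injective true false _ true ()
            l-injective true false _ false ()
            l-injective false true _ true ()
            l-injective false true _ false ()
          -- The two different wirings are those of e = false and e = true, so agreement crosses
          -- along either.
          opposite : ∀ {i j} → (c i xor c j) ≢ (c' i xor c' j) → ∀ e {k l} → Agrees c' (cor i j k l inner) →
            Agrees c' (cor j i (partnerₖ e k l) (partnerₗ e l) inner)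
          opposite {i} {j} e≢ e ag' with e ≟ᵇ (c' i xor c' j)
          ... | yes refl = proj₁ (across e≢ ag')
          ... | no e≢' rewrite trans (≢⇒≡not (e≢' ∘ sym)) (sym (≢⇒≡not (e≢ ∘ sym))) = proj₂ (across e≢ ag')
          e≢ᵀ : (c j xor c i) ≢ (c' j xor c' i)
          e≢ᵀ q = e≢ (trans (xor-comm (c i) (c j)) (trans q (xor-comm (c' j) (c' i))))
          -- Crossing by e = false and returning by e = true permutes the corners (k , l) in a
          -- single 4-cycle: 00, 11, 10, 01. The term e ∧ l in `partnerₖ` is what prevents two
          -- 2-cycles.
          rotate : ∀ {k l} → Agrees c' (cor i j k l inner) → Agrees c' (cor i j (k xor not l) (not l) inner)
          rotate {true} {true} ag' = opposite e≢ᵀ true (opposite e≢ false ag')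
          rotate {true} {false} ag' = opposite e≢ᵀ true (opposite e≢ false ag')
          rotate {false} {true} ag' = opposite e≢ᵀ true (opposite e≢ false ag')
          rotate {false} {false} ag' = opposite e≢ᵀ true (opposite e≢ false ag')
          everywhere : ∀ k l → Agrees c' (cor i j k l inner) → ∀ k' l' → Agrees c' (cor i j k' l' inner)
          everywhere k l ag' = from-origin (to-origin k l ag')
            where
            to-origin : ∀ k l → Agrees c' (cor i j k l inner) → Agrees c' (cor i j false false inner)
            to-origin false false ag' = ag'
            to-origin false true ag' = rotate ag'
            to-origin true false ag' = rotate (rotate ag')
            to-origin true true ag' = rotate (rotate (rotate ag'))
            from-origin : Agrees c' (cor i j false false inner) → ∀ k' l' → Agrees c' (cor i j k' l' inner)
            from-origin ag' false false = ag'
            from-origin ag' true true = rotate ag'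
            from-origin ag' true false = rotate (rotate ag')
            from-origin ag' false true = rotate (rotate (rotate ag'))

        agrees-everywhere : ∀ v → Agrees c v
        agrees-everywhere (cor i j k l outer) = agrees-outer i j k l
        agrees-everywhere (cor i j k l inner) = agrees-inner i j k l
        agrees-everywhere (S s) = agrees-S s
        agrees-everywhere (T s) = agrees-T s
        agrees-everywhere (tail q) = agrees-≡ c c' refl (agree (tail q))

-- The clique formed by the paths

Differ : ∀ {p} → (Fin p → Bool) → (Fin p → Bool) → Set
Differ c c' = ∃[ i ] c i ≢ c' i

-- Every vertex whose neighbours can depend on the word lies outside U, where degree 2 is forced.
-- The two ends lie in U, and the rest of the tail may lie on either side.
module Clique {p r n : ℕ} (E : Enumeration (Vertex p r) n) (U : Subset n)
  (cor∉U : ∀ i j k l t → ¬ (Enumeration.enc E (cor i j k l t) ∈ U))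
  (S∉U : ∀ s → ¬ (Enumeration.enc E (S s) ∈ U))
  (T∉U : ∀ i → ¬ (Enumeration.enc E (T (suc i)) ∈ U))
  (T∈U : Enumeration.enc E (T zero) ∈ U)
  (tail∈U : ∀ q → nxt q ≡ nothing → Enumeration.enc E (tail q) ∈ U) where

  open Enumeration E
  open Words E

  point∈S : ∀ c → InS n U (point c)
  point∈S c = PathGraph.graph∈S E (path c) ends
    where
    ends : ∀ v → other c v ≡ nothing → enc v ∈ U
    ends (cor i j k l outer) ()
    ends (cor i j k l inner) ()
    ends (T zero) _ = T∈U
    ends (tail q) e with nxt q in eq
    ... | nothing = tail∈U q eq

  classify : ∀ c c' v → SameAt (point c) (point c') (enc v) ⊎ Moved {U = U} (point c) (point c') (enc v)
  classify c c' v with ≡-decᵐ _≟ⱽ_ (other c v) (other c' v)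
  ... | yes e = inj₁ (point-≡ {c} {c'} {v} e)
  ... | no e≢ = inj₂ (moved v e≢)
    where
    moved-at : ∀ {v w w'} → ¬ (enc v ∈ U) → other c v ≡ just w → other c' v ≡ just w' →
      other c v ≢ other c' v → Moved (point c) (point c') (enc v)
    moved-at {v} {w} {w'} v∉U cw cw' e≢ = record
      { i∉U = v∉U
      ; at-x = PathGraph.neighbours₂ E (path c) cw
      ; at-y = PathGraph.neighbours₂ E (path c') cw'
      ; p≢q = λ e → e≢ (trans cw (trans (cong just (enc-injective e)) (sym cw')))
      }
    moved : ∀ v → other c v ≢ other c' v → Moved (point c) (point c') (enc v)
    moved (cor i j k l false) = moved-at (cor∉U i j k l false) refl refl
    moved (cor i j k l true) = moved-at (cor∉U i j k l true) refl refl
    moved (S s) = moved-at (S∉U s) refl refl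
    moved (T zero) e≢ = ⊥-elim (e≢ refl)
    moved (T (suc i)) = moved-at (T∉U i) refl refl
    moved (tail q) e≢ = ⊥-elim (e≢ refl)

  types : ∀ c c' i → SameAt (point c) (point c') i ⊎ Moved {U = U} (point c) (point c') i
  types c c' i = subst (λ i → SameAt (point c) (point c') i ⊎ Moved {U = U} (point c) (point c') i) (enc-dec i) (classify c c' (dec i))

  everywhere : ∀ {z} c → (∀ v → Agrees z c v) → SamePt z (point c)
  everywhere {z} c ag = adj-injective (λ i j → subst (λ i → adj z i j ≡ adj (point c) i j) (enc-dec i) (ag (dec i) j))

  -- For x = y the separating functional exposes a single point.
  isVertex : ∀ c → IsVertex n U (point c)
  isVertex c = point∈S c , vertex (separating-functional {U = U} (types c c)
    (λ _ agree → inj₁ (adj-injective (λ i → Sum.[ id , id ] (agree i)))))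
    where
    vertex : ∃[ f ] ((dot f (point c) ≡ dot f (point c)) ×
      ((z : Point n) → InS n U z → ¬ SamePt z (point c) → ¬ SamePt z (point c) → dot f z ℤ.< dot f (point c))) →
      ∃[ f ] ((z : Point n) → InS n U z → ¬ SamePt z (point c) → dot f z ℤ.< dot f (point c))
    vertex (f , _ , strict) = f , λ z z∈S z≉ → strict z z∈S z≉ z≉

  module _ {c c' : Word} {i : Fin p} (ci≢ : c i ≢ c' i) where

    start : ∀ c → Path.Nbr (path {p} {r} c) (S (inject₁ i)) (cor i (first i) false (c i) outer)
    start c rewrite lower-inject₁ i = inj₂ refl

    distinct : ¬ SamePt (point c) (point c')
    distinct same with PathGraph.enc-adj⇒Nbr E (path c') {S (inject₁ i)}
      {cor i (first i) false (c i) outer}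
      (trans (sym (adj-cong same (enc (S (inject₁ i))) (enc (cor i (first i) false (c i) outer)))) (PathGraph.Nbr⇒adj E (path c) {S (inject₁ i)} (start c)))
    ... | inj₂ e rewrite lower-inject₁ i = ci≢ (l-injective (just-injective e))
      where
      l-injective : ∀ {j k l l' t} → cor {p} {r} i j k l' t ≡ cor i j k l t → l ≡ l'
      l-injective refl = refl

    only : ∀ {z} → InS n U z → (∀ i → SameAt z (point c) i ⊎ SameAt z (point c') i) →
      SamePt z (point c) ⊎ SamePt z (point c')
    only {z} (t , (_ , acyclic) , _ , z≗t) agree = Sum.map (to-z c) (to-z c') (all (agree-t (S (inject₁ i))))
      where
      agree-t : ∀ v → Agrees t c v ⊎ Agrees t c' v
      agree-t v = Sum.map (λ e j → trans (sym (adj-cong z≗t (enc v) j)) (e j))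
        (λ e j → trans (sym (adj-cong z≗t (enc v) j)) (e j)) (agree (enc v))
      to-z : ∀ c → (∀ v → Agrees t c v) → SamePt z (point c)
      to-z c ag e = trans (z≗t e) (everywhere {t} c ag e)
      -- The choice made in one differing row decides everything: `rows-together` carries it to all
      -- other differing rows.
      all : Agrees t c (S (inject₁ i)) ⊎ Agrees t c' (S (inject₁ i)) → (∀ v → Agrees t c v) ⊎ (∀ v → Agrees t c' v)
      all (inj₁ ag) = inj₁ (agrees-everywhere t acyclic c c' agree-t
        (λ j cj≢ → rows-together t acyclic c c' agree-t ci≢ cj≢ ag))
      all (inj₂ ag') = inj₂ (agrees-everywhere t acyclic c' c (swap ∘ agree-t)
        (λ j cj≢ → rows-together t acyclic c' c (swap ∘ agree-t) (ci≢ ∘ sym) cj≢ ag'))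

    adjacent : Adjacent n U (point c) (point c')
    adjacent = isVertex c , isVertex c' , distinct , separating-functional (types c c') only

  cliqueOf : ∀ {cs} → AllPairs Differ cs → IsClique n U (map point cs)
  cliqueOf {cs} differ = All.map⁺ (All.universal isVertex cs) , AllPairs.map⁺ (AllPairs.map neighbours differ)
    where
    neighbours : ∀ {c c'} → Differ c c' → Adjacent n U (point c) (point c')
    neighbours {c} {c'} (i , ci≢) = adjacent {c} {c'} {i} ci≢

-- Placing the paths in K_n

record Split {n : ℕ} (U : Subset n) (m : ℕ) : Set where
  field
    to : Fin ∣ U ∣ ⊎ Fin m → Fin n
    from : Fin n → Fin ∣ U ∣ ⊎ Fin m
    to-from : ∀ i → to (from i) ≡ i
    from-to : ∀ x → from (to x) ≡ x
    to-inj₁ : ∀ a → to (inj₁ a) ∈ U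
    to-inj₂ : ∀ a → ¬ (to (inj₂ a) ∈ U)

split : ∀ {n} (U : Subset n) → ∃[ m ] (∣ U ∣ + m ≡ n × Split U m)
split [] = 0 , refl , record
  { to = λ { (inj₁ ()) ; (inj₂ ()) } ; from = λ () ; to-from = λ ()
  ; from-to = λ { (inj₁ ()) ; (inj₂ ()) } ; to-inj₁ = λ () ; to-inj₂ = λ () }
split (true ∷ U) with split U
... | m , e , s = m , cong suc e , record
  { to = to′ ; from = from′ ; to-from = to-from′
  ; from-to = λ { (inj₁ zero) → refl
                ; (inj₁ (suc a)) → cong (Sum.map₁ suc) (from-to (inj₁ a))
                ; (inj₂ b) → cong (Sum.map₁ suc) (from-to (inj₂ b)) }
  ; to-inj₁ = λ { zero → here ; (suc a) → there (to-inj₁ a) }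
  ; to-inj₂ = λ { b (there b∈) → to-inj₂ b b∈ }
  }
  where
  open Split s
  to′ : Fin (suc ∣ U ∣) ⊎ Fin m → Fin _
  to′ (inj₁ zero) = zero
  to′ (inj₁ (suc a)) = suc (to (inj₁ a))
  to′ (inj₂ b) = suc (to (inj₂ b))
  from′ : Fin _ → Fin (suc ∣ U ∣) ⊎ Fin m
  from′ zero = inj₁ zero
  from′ (suc i) = Sum.map₁ suc (from i)
  to-from′ : ∀ i → to′ (from′ i) ≡ i
  to-from′ zero = refl
  to-from′ (suc i) with from i | to-from i
  ... | inj₁ a | e = cong suc e
  ... | inj₂ b | e = cong suc e
split (false ∷ U) with split U
... | m , e , s = suc m , trans (ℕ.+-suc _ m) (cong suc e) , record
  { to = to′ ; from = from′ ; to-from = to-from′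
  ; from-to = λ { (inj₂ zero) → refl
                ; (inj₂ (suc b)) → cong (Sum.map₂ suc) (from-to (inj₂ b))
                ; (inj₁ a) → cong (Sum.map₂ suc) (from-to (inj₁ a)) }
  ; to-inj₁ = λ a → there (to-inj₁ a)
  ; to-inj₂ = λ { zero () ; (suc b) (there b∈) → to-inj₂ b b∈ }
  }
  where
  open Split s
  to′ : Fin ∣ U ∣ ⊎ Fin (suc m) → Fin _
  to′ (inj₁ a) = suc (to (inj₁ a))
  to′ (inj₂ zero) = zero
  to′ (inj₂ (suc b)) = suc (to (inj₂ b))
  from′ : Fin _ → Fin ∣ U ∣ ⊎ Fin (suc m)
  from′ zero = inj₂ zero
  from′ (suc i) = Sum.map₂ suc (from i)
  to-from′ : ∀ i → to′ (from′ i) ≡ i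
  to-from′ zero = refl
  to-from′ (suc i) with from i | to-from i
  ... | inj₁ a | e = cong suc e
  ... | inj₂ b | e = cong suc e

-- The corners, all the `S` and all the `T` but `T zero`, in the shape that the bijection `core`
-- takes apart.
coreSize : ℕ → ℕ
coreSize p = p * (p * (2 * (2 * 2))) + (suc p + p)

module Layout {n : ℕ} {U : Subset n} (p s u : ℕ) (∣U∣≡ : ∣ U ∣ ≡ suc (suc u)) (sp : Split U (coreSize p + s)) where

  private
    open Split sp
    module Φ = Inverse

    Core : Set
    Core = (Fin p × Fin p × Bool × Bool × Bool) ⊎ (Fin (suc p) ⊎ Fin p)

    core : Fin (coreSize p + s) ↔ (Core ⊎ Fin s)
    core = (((corners ⊎-↔ +↔⊎) ↔-∘ +↔⊎) ⊎-↔ ↔-id _) ↔-∘ +↔⊎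
      where
      bits : Fin (2 * (2 * 2)) ↔ (Bool × Bool × Bool)
      bits = (2↔Bool ×-↔ ((2↔Bool ×-↔ 2↔Bool) ↔-∘ *↔×)) ↔-∘ *↔×
      corners : Fin (p * (p * (2 * (2 * 2)))) ↔ (Fin p × Fin p × Bool × Bool × Bool)
      corners = (↔-id _ ×-↔ ((↔-id _ ×-↔ bits) ↔-∘ *↔×)) ↔-∘ *↔×

    terminals : Fin ∣ U ∣ ↔ Fin (suc (suc u))
    terminals = mk↔ₛ′ (Fin.cast ∣U∣≡) (Fin.cast (sym ∣U∣≡)) (cast-involutive ∣U∣≡ (sym ∣U∣≡)) (cast-involutive (sym ∣U∣≡) ∣U∣≡)

    -- The tail takes the s spare vertices outside U first and then all of U but the start `T zero`,
    -- so that it ends in U.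
    tails : Fin (suc (s + u)) ↔ (Fin s ⊎ Fin (suc u))
    tails = +↔⊎ ↔-∘ mk↔ₛ′ (Fin.cast eq) (Fin.cast (sym eq)) (cast-involutive eq (sym eq)) (cast-involutive (sym eq) eq)
      where
      eq : suc (s + u) ≡ s + suc u
      eq = sym (ℕ.+-suc s u)

    V : Set
    V = Vertex p (s + u)

    encode : V → Fin (suc (suc u)) ⊎ (Core ⊎ Fin s)
    encode (cor i j k l t) = inj₂ (inj₁ (inj₁ (i , j , k , l , t)))
    encode (S i) = inj₂ (inj₁ (inj₂ (inj₁ i)))
    encode (T zero) = inj₁ zero
    encode (T (suc i)) = inj₂ (inj₁ (inj₂ (inj₂ i)))
    encode (tail q) = Sum.swap (Sum.map inj₂ suc (Φ.to tails q))

    decode : Fin (suc (suc u)) ⊎ (Core ⊎ Fin s) → V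
    decode (inj₂ (inj₁ (inj₁ (i , j , k , l , t)))) = cor i j k l t
    decode (inj₂ (inj₁ (inj₂ (inj₁ i)))) = S i
    decode (inj₁ zero) = T zero
    decode (inj₂ (inj₁ (inj₂ (inj₂ i)))) = T (suc i)
    decode (inj₁ (suc q)) = tail (Φ.from tails (inj₂ q))
    decode (inj₂ (inj₂ q)) = tail (Φ.from tails (inj₁ q))

    decode-encode : ∀ v → decode (encode v) ≡ v
    decode-encode (cor i j k l t) = refl
    decode-encode (S i) = refl
    decode-encode (T zero) = refl
    decode-encode (T (suc i)) = refl
    decode-encode (tail q) with Φ.to tails q | Φ.strictlyInverseʳ tails q
    ... | inj₁ _ | e = cong tail e
    ... | inj₂ _ | e = cong tail e

    encode-decode : ∀ x → encode (decode x) ≡ x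
    encode-decode (inj₂ (inj₁ (inj₁ _))) = refl
    encode-decode (inj₂ (inj₁ (inj₂ (inj₁ _)))) = refl
    encode-decode (inj₂ (inj₁ (inj₂ (inj₂ _)))) = refl
    encode-decode (inj₁ zero) = refl
    encode-decode (inj₁ (suc q)) = cong (Sum.swap ∘ Sum.map inj₂ suc) (Φ.strictlyInverseˡ tails (inj₂ q))
    encode-decode (inj₂ (inj₂ q)) = cong (Sum.swap ∘ Sum.map inj₂ suc) (Φ.strictlyInverseˡ tails (inj₁ q))

    places : (Fin ∣ U ∣ ⊎ Fin (coreSize p + s)) ↔ V
    places = mk↔ₛ′ decode encode decode-encode encode-decode ↔-∘ (terminals ⊎-↔ core)

  enumeration : Enumeration V n
  enumeration = record
    { enc = to ∘ Φ.from places
    ; dec = Φ.to places ∘ from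
    ; dec-enc = λ v → trans (cong (Φ.to places) (from-to _)) (Φ.strictlyInverseˡ places v)
    ; enc-dec = λ i → trans (cong to (Φ.strictlyInverseʳ places (from i))) (to-from i)
    }

  private
    open Enumeration enumeration

    last∈U : ∀ q → nxt q ≡ nothing → enc (tail q) ∈ U
    last∈U q e rewrite nxt-nothing q q e
      | splitAt-≥ s (Fin.cast (sym (ℕ.+-suc s u)) (fromℕ (s + u)))
          (subst (s ≤_) (sym (trans (toℕ-cast (sym (ℕ.+-suc s u)) (fromℕ (s + u))) (toℕ-fromℕ (s + u)))) (ℕ.m≤m+n s u)) = to-inj₁ _

  open Clique enumeration U (λ i j k l t → to-inj₂ _) (λ i → to-inj₂ _) (λ i → to-inj₂ _) (to-inj₁ _) last∈U public

-- Number of words and the numerical bound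

words : ∀ p → List (Fin p → Bool)
words zero = (λ ()) ∷ []
words (suc p) = List.map (false Vector.∷_) (words p) ++ List.map (true Vector.∷_) (words p)

length-words : ∀ p → length (words p) ≡ 2 ^ p
length-words zero = refl
length-words (suc p)
  rewrite length-++ (List.map (false Vector.∷_) (words p)) {List.map (true Vector.∷_) (words p)}
  | length-map (false Vector.∷_) (words p) | length-map (true Vector.∷_) (words p)
  | length-words p | ℕ.+-identityʳ (2 ^ p) = refl

words-differ : ∀ p → AllPairs Differ (words p)
words-differ zero = [] ∷ []
words-differ (suc p) = AllPairs.++⁺ (extended false) (extended true)
  (All.map⁺ (All.universal (λ _ → All.map⁺ (All.universal (λ _ → zero , λ ()) (words p))) (words p)))
  where
  extended : ∀ a → AllPairs Differ (List.map (a Vector.∷_) (words p))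
  extended a = AllPairs.map⁺ (AllPairs.map (λ (i , ci≢) → suc i , ci≢) (words-differ p))

-- Comparing squares gives a ≤ q (2 p + 9), and 2 ^ (2 p + 9) is 2 ^ 9 times the square of 2 ^ p.
sqrt-bound : ∀ m p → m ≤ (2 * p + 9) * (2 * p + 9) → BoundHolds m (2 ^ p)
sqrt-bound m p m≤ a q _ a²≤ = begin
  2 ^ a ≤⟨ ℕ.^-monoʳ-≤ 2 a≤ ⟩
  2 ^ (q * (2 * p + 9)) ≡⟨ cong (2 ^_) (exponent q p) ⟩
  2 ^ (9 * q + p * (2 * q)) ≡⟨ ℕ.^-distribˡ-+-* 2 (9 * q) (p * (2 * q)) ⟩
  2 ^ (9 * q) * 2 ^ (p * (2 * q)) ≡⟨ cong (2 ^ (9 * q) *_) (ℕ.^-*-assoc 2 p (2 * q)) ⟨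
  2 ^ (9 * q) * (2 ^ p) ^ (2 * q) ∎
  where
  open ℕ.≤-Reasoning
  exponent : ∀ q p → q * (2 * p + 9) ≡ 9 * q + p * (2 * q)
  exponent = solve 2 (λ q p → q :* (con 2 :* p :+ con 9) := con 9 :* q :+ p :* (con 2 :* q)) refl
    where open +-*-Solver
  square : ∀ q x → q * q * (x * x) ≡ q * x * (q * x)
  square = solve 2 (λ q x → q :* q :* (x :* x) := q :* x :* (q :* x)) refl
    where open +-*-Solver
  a≤ : a ≤ q * (2 * p + 9)
  a≤ with a ℕ.≤? q * (2 * p + 9)
  ... | yes le = le
  ... | no ≰ = ⊥-elim (ℕ.<⇒≱ (ℕ.*-mono-< (ℕ.≰⇒> ≰) (ℕ.≰⇒> ≰))
    (ℕ.≤-trans a²≤ (subst (q * q * m ≤_) (square q (2 * p + 9)) (ℕ.*-monoʳ-≤ (q * q) m≤))))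

-- √m ≤ 2 p + 9 makes 2 ^ p large enough, and 2 p + 7 ≤ √m leaves room for the paths.
wordLength : ∀ m → ∃[ p ] (m ≤ (2 * p + 9) * (2 * p + 9) × (p ≡ 0 ⊎ (2 * p + 7) * (2 * p + 7) ≤ m))
wordLength zero = 0 , z≤n , inj₁ refl
wordLength (suc m) with wordLength m
... | p , m≤ , least with suc m ℕ.≤? (2 * p + 9) * (2 * p + 9)
...   | yes m<  = p , m< , Sum.map₂ (λ le → ℕ.m≤n⇒m≤1+n le) least
...   | no m≮ = suc p , ℕ.≤-trans (s≤s m≤) (ℕ.*-mono-< 9< 9<) , inj₂ (subst (λ x → x * x ≤ suc m) 9≡ (ℕ.<⇒≤ (ℕ.≰⇒> m≮)))
  where
  9≡ : 2 * p + 9 ≡ 2 * suc p + 7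
  9≡ = solve 1 (λ p → con 2 :* p :+ con 9 := con 2 :* (con 1 :+ p) :+ con 7) refl p
    where open +-*-Solver
  9< : 2 * p + 9 ℕ.< 2 * suc p + 9
  9< = ℕ.+-monoˡ-< 9 (ℕ.*-monoʳ-< 2 (ℕ.n<1+n p))

-- Undoing the halving gives k ≥ 2 (2 p + 7)² + 1, whose leading term 8 p² is the number of corner
-- vertices. The rest exceeds 2 p + 1 by 54 p + 98.
coreSize-≤ : ∀ p k → 1 ≤ k → p ≡ 0 ⊎ (2 * p + 7) * (2 * p + 7) ≤ (k ∸ 1) / 2 → coreSize p ≤ k
coreSize-≤ p k 1≤k (inj₁ refl) = 1≤k
coreSize-≤ p (suc k) _ (inj₂ le) = ℕ.≤-trans (ℕ.m≤m+n (coreSize p) (54 * p + 98))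
  (ℕ.≤-trans (ℕ.≤-reflexive (sym (eq p)))
    (s≤s (ℕ.≤-trans (ℕ.*-monoˡ-≤ 2 le) (m/n*n≤m k 2))))
  where
  eq : ∀ p → suc ((2 * p + 7) * (2 * p + 7) * 2) ≡ coreSize p + (54 * p + 98)
  eq = solve 1 (λ p → con 1 :+ (con 2 :* p :+ con 7) :* (con 2 :* p :+ con 7) :* con 2 :=
    (p :* (p :* con 8) :+ (con 1 :+ p :+ p)) :+ (con 54 :* p :+ con 98)) refl
    where open +-*-Solver

cube-clique : ∀ {n} {U : Subset n} p s u → ∣ U ∣ ≡ suc (suc u) → Split U (coreSize p + s) →
  Σ (List (Point n)) (λ xs → IsClique n U xs × length xs ≡ 2 ^ p)
cube-clique p s u ∣U∣≡ sp = List.map (Words.point enumeration) (words p) , cliqueOf (words-differ p) ,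
  trans (length-map (Words.point enumeration) (words p)) (length-words p)
  where open Layout p s u ∣U∣≡ sp

theorem7 : (n : ℕ) → (U : Subset n) → 1 ≤ n → 2 ≤ ∣ U ∣ → ∣ U ∣ ≤ n ∸ 1 →
    Σ (List (Point n)) (λ xs → IsClique n U xs × BoundHolds (mOf n U) (length xs))
theorem7 n U 1≤n 2≤∣U∣ ∣U∣<n = assemble (split U) (wordLength (mOf n U))
  where
  assemble : ∃[ m ] (∣ U ∣ + m ≡ n × Split U m) →
    ∃[ p ] (mOf n U ≤ (2 * p + 9) * (2 * p + 9) × (p ≡ 0 ⊎ (2 * p + 7) * (2 * p + 7) ≤ mOf n U)) →
    Σ (List (Point n)) (λ xs → IsClique n U xs × BoundHolds (mOf n U) (length xs))
  assemble (m , ∣U∣+m≡n , sp) (p , small , least) =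
    let xs , clique , length≡ = cube-clique p (m ∸ coreSize p) (∣ U ∣ ∸ 2)
          (sym (ℕ.m+[n∸m]≡n 2≤∣U∣)) (subst (Split U) (sym (ℕ.m+[n∸m]≡n core≤m)) sp)
    in xs , clique , subst (BoundHolds (mOf n U)) (sym length≡) (sqrt-bound (mOf n U) p small)
    where
    m≡ : n ∸ ∣ U ∣ ≡ m
    m≡ = trans (cong (_∸ ∣ U ∣) (sym ∣U∣+m≡n)) (ℕ.m+n∸m≡n ∣ U ∣ m)
    -- Even for p = 0 the path needs one vertex outside U, namely `S zero`.
    1≤m : 1 ≤ m
    1≤m = subst (1 ≤_) m≡ (ℕ.m<n⇒0<n∸m (subst (∣ U ∣ ℕ.<_) (ℕ.m+[n∸m]≡n 1≤n) (s≤s ∣U∣<n)))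
    core≤m : coreSize p ≤ m
    core≤m = coreSize-≤ p m 1≤m (Sum.map₂ (subst (λ k → (2 * p + 7) * (2 * p + 7) ≤ (k ∸ 1) / 2) m≡) least)
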